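{- Let $r_1,s_1,r_2,s_2\ge2$ be integers, let $\boldsymbol{\lambda}=(\lambda_1,\lambda_2)\in(0,\infty)^2$, and put $h_*=\min\{r_1+s_1-1,\,r_2+s_2-1\}$, $e_i=r_i+s_i-2$ for $i\in\{1,2\}$, and $R=\overline{\mathrm{R}}(\mathcal{S}_{r_1,s_1},\mathcal{S}_{r_2,s_2})$. For all integers $R\le t\le n$, $$\overline{\mathrm{M}}_{\boldsymbol{\lambda}}(n;\mathcal{S}_{r_1,s_1},\mathcal{S}_{r_2,s_2})\ \ge\ \overline{\mathrm{M}}_{\boldsymbol{\lambda}}(t;\mathcal{S}_{r_1,s_1},\mathcal{S}_{r_2,s_2})\,\frac{\binom{n}{h_*}}{\binom{t}{h_*}}.$$ Moreover, $$\overline{\mathrm{M}}_{\boldsymbol{\lambda}}(n;\mathcal{S}_{r_1,s_1},\mathcal{S}_{r_2,s_2})\ \le\ \min_{0\le p\le1}\left[\lambda_1p^{e_1}\binom{n}{r_1+s_1-1}+\lambda_2(1-p)^{e_2}\binom{n}{r_2+s_2-1}\right].$$ If in addition $t\ge\max\{r_1+s_1-1,\,r_2+s_2-1\}$, then every red--blue coloring of the edges of $\mathcal{K}_n$ (color $1$ = red, color $2$ = blue) contains, for some $i\in\{1,2\}$, at least $$\frac{\overline{\mathrm{M}}_{\boldsymbol{\lambda}}(t;\mathcal{S}_{r_1,s_1},\mathcal{S}_{r_2,s_2})}{2\lambda_i}\cdot\frac{\binom{n}{r_i+s_i-1}}{\binom{t}{r_i+s_i-1}}$$ copies of $\mathcal{S}_{r_i,s_i}$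 in color $i$.
   Context: An ordered graph is a finite graph with a linear order on its vertex set. $\mathcal{K}_n$ is the complete graph on $[n]=\{1,\ldots,n\}$ with the natural order. For integers $r,s\ge1$, $\mathcal{S}_{r,s}$ is the ordered star whose center has $r-1$ leaves to its left (preceding it) and $s-1$ leaves to its right (following it); it has $r+s-1$ vertices. An order-preserving copy of an ordered graph $\mathcal{H}$ in $\mathcal{G}$ is an injective map $V(\mathcal{H})\to V(\mathcal{G})$ that preserves the vertex order and maps every edge of $\mathcal{H}$ to an edge of $\mathcal{G}$; copies are counted by their vertex sets (an $h$-element vertex set supports at most one copy of a fixed $h$-vertex ordered graph). For ordered graphs $\mathcal{G}_1,\mathcal{G}_2$ and a coloring $\chi:E(\mathcal{K}_n)\to\{1,2\}$, $N_i(\chi;\mathcal{G}_i)$ is the number of order-preserving copies of $\mathcal{G}_i$ in $\mathcal{K}_n$ all of whose edges have color $i$. $\overline{\mathrm{R}}(\mathcal{G}_1,\mathcal{G}_2)$ is the least $N$ such that every $\chi:E(\mathcal{K}_N)\to\{1,2\}$ contains an order-preserving copy of $\mathcal{G}_i$ in color $i$ for some $i\in\{1,2\}$. The weighted ordered multiplicity is $$\overline{\mathrm{M}}_{\boldsymbol{\lambda}}(n;\mathcal{G}_1,\mathcal{G}_2)=\min_{\chi:E(\mathcal{K}_n)\to\{1,2\}}\bigl(\lambda_1N_1(\chi;\mathcal{G}_1)+\lambda_2N_2(\chi;\mathcal{G}_2)\bigr).$$ Convention: $\binom{x}{q}=0$ when $q<0$ or $q>x$. -}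

module Defs where

open import Algebra.Bundles using (CommutativeRing; Semiring)
open import Algebra.Core using (Op₁; Op₂)
open import Algebra.Structures using (IsCommutativeRing)
import Algebra.Definitions.RawSemiring as RawSemiringDefs
open import Data.Bool.Base using (Bool; false; not; _xor_; T)
import Data.Bool.Properties as Bool
open import Data.Fin.Base as Fin using (Fin; toℕ)
open import Data.Fin.Patterns using (0F; 1F)
import Data.Fin.Properties as Fin
open import Data.Fin.Subset using (Subset; inside; outside; ⋃; ⁅_⁆)
open import Data.List.Base as List
  using (List; []; _∷_; _++_; allFin; cartesianProduct; cartesianProductWith;
         filter; length; mapMaybe)
import Data.List.Extrema as Extrema
open import Data.List.Membership.Propositional using (_∈_)
open import Data.List.Membership.Propositional.Properties
  using (∈-allFin; ∈-cartesianProduct⁺; ∈-cartesianProductWith⁺)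
open import Data.List.Properties using (filter-≐)
import Data.List.Relation.Unary.All as All
open import Data.List.Relation.Unary.Any using (here; there)
open import Data.Maybe.Base using (Maybe; just; nothing)
open import Data.Nat.Base as ℕ using (ℕ; zero; suc; _∸_)
open import Data.Nat.Combinatorics using (_C_)
import Data.Nat.Properties as ℕ
open import Data.Product.Base using (Σ-syntax; ∃; _×_; _,_; proj₁; proj₂)
open import Data.Unit.Base using (⊤)
open import Data.Vec.Base as Vec using (Vec; lookup; toList)
open import Data.Vec.Properties using (≡-dec)
open import Function.Base using (_∘_)
open import Level using (_⊔_; 0ℓ) renaming (suc to lsuc)
open import Relation.Binary.Bundles using (TotalOrder)
open import Relation.Binary.Core using (Rel)
open import Relation.Binary.PropositionalEquality
  using (_≡_; _≗_; refl; sym; trans; cong; cong₂; subst)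
open import Relation.Binary.Structures using (IsDecTotalOrder)
import Relation.Binary.Construct.NonStrictToStrict as NonStrictToStrict
open import Relation.Nullary.Decidable
  using (Dec; yes; no; does; map′; _×-dec_; _→-dec_; dec-true; recompute)
open import Relation.Nullary.Negation using (¬_; contradiction)
open import Relation.Unary using (Pred; Satisfiable)

-- The standard library has no real numbers, so they are given by their
-- axioms: a Dedekind-complete totally ordered field.  Decidability of the
-- order expresses that ℝ is the classical real line.  The value of the
-- inverse at 0 is unspecified.

record CompleteOrderedField c ℓ₁ ℓ₂ : Set (lsuc (c ⊔ ℓ₁ ⊔ ℓ₂)) where
  infix  4 _≈_ _≤_ _<_
  infixl 6 _+_ _-_
  infixl 7 _*_ _/_
  infix  8 -_ _⁻¹
  field
    Carrier           : Set c
    _≈_               : Rel Carrier ℓ₁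
    _≤_               : Rel Carrier ℓ₂
    _+_ _*_           : Op₂ Carrier
    -_ _⁻¹            : Op₁ Carrier
    0# 1#             : Carrier
    isCommutativeRing : IsCommutativeRing _≈_ _+_ _*_ -_ 0# 1#
    isDecTotalOrder   : IsDecTotalOrder _≈_ _≤_
    0≉1               : ¬ 0# ≈ 1#
    ⁻¹-cong           : ∀ {x y} → x ≈ y → x ⁻¹ ≈ y ⁻¹
    *-inverseʳ        : ∀ x → ¬ x ≈ 0# → x * x ⁻¹ ≈ 1#
    +-monoˡ-≤         : ∀ z {x y} → x ≤ y → x + z ≤ y + z
    *-nonNeg          : ∀ {x y} → 0# ≤ x → 0# ≤ y → 0# ≤ x * y

  _IsUpperBoundOf_ : Carrier → Pred Carrier ℓ₂ → Set (c ⊔ ℓ₂)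
  b IsUpperBoundOf P = ∀ x → P x → x ≤ b

  field
    supremum : (P : Pred Carrier ℓ₂) → Satisfiable P → ∃ (_IsUpperBoundOf P) →
               Σ[ s ∈ Carrier ] s IsUpperBoundOf P × (∀ b → b IsUpperBoundOf P → s ≤ b)

  commutativeRing : CommutativeRing c ℓ₁
  commutativeRing = record { isCommutativeRing = isCommutativeRing }

  totalOrder : TotalOrder c ℓ₁ ℓ₂
  totalOrder = record { isTotalOrder = IsDecTotalOrder.isTotalOrder isDecTotalOrder }

  _<_ : Rel Carrier (ℓ₁ ⊔ ℓ₂)
  _<_ = NonStrictToStrict._<_ _≈_ _≤_

  open RawSemiringDefs (Semiring.rawSemiring (CommutativeRing.semiring commutativeRing)) public
    using (_^_) renaming (_×_ to _·_)

  _-_ _/_ : Op₂ Carrier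
  x - y = x + - y
  x / y = x * y ⁻¹

  fromℕ : ℕ → Carrier
  fromℕ n = n · 1#

  binom : ℕ → ℕ → Carrier
  binom n k = fromℕ (n C k)

  UnitInterval : Pred Carrier ℓ₂
  UnitInterval p = 0# ≤ p × p ≤ 1#

  record IsMinimum {a p} {A : Set a} (P : Pred A p) (f : A → Carrier) (m : Carrier)
         : Set (a ⊔ p ⊔ c ⊔ ℓ₁ ⊔ ℓ₂) where
    field
      attained   : Σ[ x ∈ A ] P x × m ≈ f x
      lowerBound : ∀ x → P x → m ≤ f x

-- The vertex set is Fin size with its natural order, which is the general
-- case up to a unique isomorphism.

record OrderedGraph : Set where
  field
    size        : ℕ
    adj         : Fin size → Fin size → Bool
    symmetric   : ∀ u v → adj u v ≡ adj v u
    irreflexive : ∀ v → adj v v ≡ false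

  Vertex : Set
  Vertex = Fin size

  Adj : Rel Vertex 0ℓ
  Adj u v = T (adj u v)

open OrderedGraph using (size; Vertex; Adj)

-- The proof fields are irrelevant, so an edge is determined by its ends.

record Edge (G : OrderedGraph) : Set where
  constructor edge
  field
    left right  : Vertex G
    .left<right : left Fin.< right
    .adjacent   : Adj G left right

𝒦 : ℕ → OrderedGraph
𝒦 n = record
  { size        = n
  ; adj         = λ u v → not (does (u Fin.≟ v))
  ; symmetric   = λ u v → cong not (≟-sym u v)
  ; irreflexive = λ v → cong not (dec-true (v Fin.≟ v) refl)
  }
  where
  ≟-sym : ∀ (u v : Fin n) → does (u Fin.≟ v) ≡ does (v Fin.≟ u)
  ≟-sym u v with u Fin.≟ v | v Fin.≟ u
  ... | yes _   | yes _   = refl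
  ... | no  _   | no  _   = refl
  ... | yes u≡v | no  v≢u = contradiction (sym u≡v) v≢u
  ... | no  u≢v | yes v≡u = contradiction (sym v≡u) u≢v

-- For r, s ≥ 1.  Counting vertices from 0, the centre is vertex r - 1, and two
-- vertices are adjacent exactly when one but not the other is the centre.

𝒮 : ℕ → ℕ → OrderedGraph
𝒮 r s = record
  { size        = r ℕ.+ s ∸ 1
  ; adj         = λ u v → centre u xor centre v
  ; symmetric   = λ u v → Bool.xor-comm (centre u) (centre v)
  ; irreflexive = λ v → Bool.xor-same (centre v)
  }
  where
  centre : Fin (r ℕ.+ s ∸ 1) → Bool
  centre v = does (toℕ v ℕ.≟ r ∸ 1)

-- A map V(H) → V(G) is given by its tuple of values.  Preserving the strict
-- order makes it injective.

record IsCopy (H G : OrderedGraph) (f : Vec (Vertex G) (size H)) : Set where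
  constructor isCopy
  field
    mono : ∀ u v → u Fin.< v → lookup f u Fin.< lookup f v
    adj  : ∀ u v → Adj H u v → Adj G (lookup f u) (lookup f v)

vertexSet : ∀ {m n} → Vec (Fin n) m → Subset n
vertexSet f = ⋃ (List.map ⁅_⁆ (toList f))

mapEdge : ∀ {H G f} → .(IsCopy H G f) → Edge H → Edge G
mapEdge {f = f} c (edge u v u<v u~v) =
  edge (lookup f u) (lookup f v) (IsCopy.mono c u v u<v) (IsCopy.adj c u v u~v)

Color : Set
Color = Fin 2

-- Red is colour 1 and blue is colour 2.
pattern red  = 0F
pattern blue = 1F

Coloring : ℕ → Set
Coloring n = Edge (𝒦 n) → Color

MonochromaticCopy : ∀ {n} → Coloring n → Color → (H : OrderedGraph) →
                    Vec (Fin n) (size H) → Set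
MonochromaticCopy {n} χ i H f =
  Σ[ c ∈ IsCopy H (𝒦 n) f ] (∀ e → χ (mapEdge c e) ≡ i)

HasCopyOn : ∀ {n} → Coloring n → Color → OrderedGraph → Subset n → Set
HasCopyOn χ i H S = ∃ λ f → MonochromaticCopy χ i H f × vertexSet f ≡ S

Arrows : ℕ → (Color → OrderedGraph) → Set
Arrows N G = (χ : Coloring N) → Σ[ i ∈ Color ] ∃ (MonochromaticCopy χ i (G i))

record IsOrderedRamseyNumber (G : Color → OrderedGraph) (R : ℕ) : Set where
  field
    arrows : Arrows R G
    least  : ∀ N → Arrows N G → R ℕ.≤ N

anyVec? : ∀ {n m} {P : Pred (Vec (Fin n) m) 0ℓ} → (∀ f → Dec (P f)) → Dec (∃ P)
anyVec? {m = zero}  P? =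
  map′ (Vec.[] ,_) (λ { (Vec.[] , p) → p }) (P? Vec.[])
anyVec? {m = suc m} P? =
  map′ (λ (x , xs , p) → x Vec.∷ xs , p) (λ { (x Vec.∷ xs , p) → x , xs , p })
       (Fin.any? λ x → anyVec? λ xs → P? (x Vec.∷ xs))

isCopy? : ∀ H G f → Dec (IsCopy H G f)
isCopy? H G f =
  map′ (λ (m , a) → isCopy m a) (λ c → IsCopy.mono c , IsCopy.adj c)
    ((Fin.all? λ u → Fin.all? λ v → (u Fin.<? v) →-dec (lookup f u Fin.<? lookup f v))
     ×-dec
     (Fin.all? λ u → Fin.all? λ v →
        Bool.T? (OrderedGraph.adj H u v) →-dec
        Bool.T? (OrderedGraph.adj G (lookup f u) (lookup f v))))

allEdges? : ∀ {G} {P : Pred (Edge G) 0ℓ} → (∀ e → Dec (P e)) → Dec (∀ e → P e)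
allEdges? {G} {P} P? = map′ fromEnds toEnds (Fin.all? λ u → Fin.all? λ v → atEnds u v)
  where
  AtEnds : Vertex G → Vertex G → Set
  AtEnds u v = .(u<v : u Fin.< v) .(u~v : Adj G u v) → P (edge u v u<v u~v)

  fromEnds : (∀ u v → AtEnds u v) → ∀ e → P e
  fromEnds p (edge u v u<v u~v) = p u v u<v u~v

  toEnds : (∀ e → P e) → ∀ u v → AtEnds u v
  toEnds p u v u<v u~v = p (edge u v u<v u~v)

  atEnds : ∀ u v → Dec (AtEnds u v)
  atEnds u v with u Fin.<? v | Bool.T? (OrderedGraph.adj G u v)
  ... | no u≮v | _      = yes λ u<v _ → contradiction (recompute (u Fin.<? v) u<v) u≮v
  ... | yes _  | no u≁v =
    yes λ _ u~v → contradiction (recompute (Bool.T? (OrderedGraph.adj G u v)) u~v) u≁v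
  ... | yes u<v | yes u~v = map′ (λ p _ _ → p) (λ p → p u<v u~v) (P? (edge u v u<v u~v))

monochromaticCopy? : ∀ {n} (χ : Coloring n) i H f → Dec (MonochromaticCopy χ i H f)
monochromaticCopy? {n} χ i H f with isCopy? H (𝒦 n) f
... | no ¬c = no (¬c ∘ proj₁)
... | yes c = map′ (c ,_) proj₂ (allEdges? λ e → χ (mapEdge c e) Fin.≟ i)

hasCopyOn? : ∀ {n} (χ : Coloring n) i H S → Dec (HasCopyOn χ i H S)
hasCopyOn? χ i H S =
  anyVec? λ f → monochromaticCopy? χ i H f ×-dec ≡-dec Bool._≟_ (vertexSet f) S

subsets : ∀ n → List (Subset n)
subsets zero    = Vec.[] ∷ []
subsets (suc n) =
  List.map (outside Vec.∷_) (subsets n) ++ List.map (inside Vec.∷_) (subsets n)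

-- Copies are counted by their vertex sets.

copies : ∀ {n} → Coloring n → Color → OrderedGraph → ℕ
copies {n} χ i H = length (filter (hasCopyOn? χ i H) (subsets n))

copies-cong : ∀ {n} {χ χ′ : Coloring n} → χ ≗ χ′ → ∀ i H → copies χ i H ≡ copies χ′ i H
copies-cong {n} {χ} {χ′} χ≗χ′ i H = cong length
  (filter-≐ (hasCopyOn? χ i H) (hasCopyOn? χ′ i H) (to χ≗χ′ , to (sym ∘ χ≗χ′)) (subsets n))
  where
  to : ∀ {χ χ′ : Coloring n} → χ ≗ χ′ → ∀ {S} → HasCopyOn χ i H S → HasCopyOn χ′ i H S
  to eq (f , (c , mono) , S≡) = f , (c , λ e → trans (sym (eq (mapEdge c e))) (mono e)) , S≡

toEdge : ∀ {n} → Fin n × Fin n → Maybe (Edge (𝒦 n))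
toEdge {n} (u , v) with u Fin.<? v | Bool.T? (OrderedGraph.adj (𝒦 n) u v)
... | yes u<v | yes u~v = just (edge u v u<v u~v)
... | _       | _       = nothing

edges : ∀ n → List (Edge (𝒦 n))
edges n = mapMaybe toEdge (cartesianProduct (allFin n) (allFin n))

_≟ᴱ_ : ∀ {G} (e e′ : Edge G) → Dec (e ≡ e′)
edge u v _ _ ≟ᴱ edge u′ v′ _ _ =
  map′ (λ { (refl , refl) → refl }) (λ { refl → refl , refl })
       ((u Fin.≟ u′) ×-dec (v Fin.≟ v′))

paint : ∀ {n} → Edge (𝒦 n) → Color → Coloring n → Coloring n
paint e i χ e′ with e ≟ᴱ e′
... | yes _ = i
... | no  _ = χ e′

-- All colourings in which every edge outside the list is red.

coloringsOf : ∀ {n} → List (Edge (𝒦 n)) → List (Coloring n)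
coloringsOf []       = (λ _ → red) ∷ []
coloringsOf (e ∷ es) = cartesianProductWith (paint e) (allFin 2) (coloringsOf es)

colorings : ∀ n → List (Coloring n)
colorings n = coloringsOf (edges n)

∈-edges : ∀ {n} (e : Edge (𝒦 n)) → e ∈ edges n
∈-edges {n} e@(edge u v u<v u~v) =
  ∈-mapMaybe (∈-cartesianProduct⁺ (∈-allFin u) (∈-allFin v)) toEdge-ends
  where
  ∈-mapMaybe : ∀ {x xs} → x ∈ xs → toEdge x ≡ just e → e ∈ mapMaybe toEdge xs
  ∈-mapMaybe {x} (here refl) eq with just _ ← toEdge x | refl ← eq = here refl
  ∈-mapMaybe (there {x = y} x∈) eq with toEdge y
  ... | just _  = there (∈-mapMaybe x∈ eq)
  ... | nothing = ∈-mapMaybe x∈ eq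

  toEdge-ends : toEdge (u , v) ≡ just e
  toEdge-ends with u Fin.<? v | Bool.T? (OrderedGraph.adj (𝒦 n) u v)
  ... | yes _  | yes _  = refl
  ... | yes _  | no u≁v =
    contradiction (recompute (Bool.T? (OrderedGraph.adj (𝒦 n) u v)) u~v) u≁v
  ... | no u≮v | _      = contradiction (recompute (u Fin.<? v) u<v) u≮v

coloringsOf-complete : ∀ {n} (es : List (Edge (𝒦 n))) (χ : Coloring n) →
  Σ[ χ′ ∈ Coloring n ] χ′ ∈ coloringsOf es × (∀ {e} → e ∈ es → χ′ e ≡ χ e)
coloringsOf-complete []       χ = _ , here refl , λ ()
coloringsOf-complete (e ∷ es) χ with coloringsOf-complete es χ
... | χ′ , χ′∈ , agree =
  paint e (χ e) χ′ , ∈-cartesianProductWith⁺ (paint e) (∈-allFin (χ e)) χ′∈ , agree′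
  where
  agree′ : ∀ {e′} → e′ ∈ e ∷ es → paint e (χ e) χ′ e′ ≡ χ e′
  agree′ {e′} e′∈ with e ≟ᴱ e′ | e′∈
  ... | yes refl | _          = refl
  ... | no  e≢e′ | here e′≡e  = contradiction (sym e′≡e) e≢e′
  ... | no  _    | there e′∈′ = agree e′∈′

colorings-complete : ∀ {n} (χ : Coloring n) → Σ[ χ′ ∈ Coloring n ] χ′ ∈ colorings n × χ′ ≗ χ
colorings-complete {n} χ =
  let χ′ , χ′∈ , agree = coloringsOf-complete (edges n) χ
  in χ′ , χ′∈ , λ e → agree (∈-edges e)

module Multiplicity {c ℓ₁ ℓ₂} (ℝ : CompleteOrderedField c ℓ₁ ℓ₂) where

  open CompleteOrderedField ℝ
  open Extrema totalOrder using (argmin; f[argmin]≤f[xs])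

  weight : ∀ {n} → (Color → Carrier) → (Color → OrderedGraph) → Coloring n → Carrier
  weight w G χ = w red  * fromℕ (copies χ red  (G red))
               + w blue * fromℕ (copies χ blue (G blue))

  multiplicity : (Color → Carrier) → ℕ → (Color → OrderedGraph) → Carrier
  multiplicity w n G = weight w G (argmin (weight w G) (λ _ → red) (colorings n))

  multiplicity-isMinimum : ∀ w n G →
    IsMinimum {A = Coloring n} (λ _ → ⊤) (weight w G) (multiplicity w n G)
  multiplicity-isMinimum w n G = record
    { attained   = _ , _ , ≈-refl
    ; lowerBound = λ χ _ →
        let χ′ , χ′∈ , χ′≗χ = colorings-complete χ
        in subst (multiplicity w n G ≤_) (weight-cong χ′≗χ)
             (All.lookup (f[argmin]≤f[xs] {f = weight w G} _ (colorings n)) χ′∈)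
    }
    where
    open CommutativeRing commutativeRing using () renaming (refl to ≈-refl)

    weight-cong : ∀ {χ χ′ : Coloring n} → χ ≗ χ′ → weight w G χ ≡ weight w G χ′
    weight-cong eq = cong₂ (λ a b → w red * fromℕ a + w blue * fromℕ b)
      (copies-cong eq red (G red)) (copies-cong eq blue (G blue))

{-# OPTIONS --safe #-}

-- A copy of 𝒮 r s in 𝒦 n survives the deletion of exactly the n - h vertices
-- outside it, so averaging over the n deletions shows that the multiplicity for
-- n - 1 is at most the weight of any colouring of 𝒦 n after scaling the term of
-- colour i by (n - h i) / n.  Iterating from n down to t turns these factors into
-- C(t, h i) / C(n, h i), and the first bound follows since C(t, h) / C(n, h)
-- decreases in h.  For the upper bound, colour the edges independently, red with
-- probability p: an h i-element set supports a monochromatic star with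
-- probability p ^ e red or (1 - p) ^ e blue, and some colouring does at least as
-- well as the expectation.  This polynomial in p is convex on [0, 1], and its
-- minimum is found without the extreme value theorem, as a zero of its derivative.

module Submission where

open import Defs
open import Algebra.Bundles using (CommutativeRing)
import Algebra.Properties.AbelianGroup as AbelianGroupProperties
import Algebra.Properties.Ring as RingProperties
import Algebra.Properties.Semiring.Mult as Mult
import Algebra.Solver.Ring.NaturalCoefficients.Default as SemiringSolver
open import Data.Bool.Base using (Bool; true; false; if_then_else_; T; _xor_)
import Data.Bool.Properties as Bool
open import Data.Empty using (⊥-elim)
open import Data.Fin.Base as Fin using (Fin; zero; suc; toℕ; punchIn; _↑ˡ_; _↑ʳ_)
import Data.Fin.Properties as Fin
open import Data.Fin.Subset using (Subset; inside; outside; ⊥; ⁅_⁆; _∪_; ∣_∣)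
  renaming (_∈_ to _∈ˢ_; _∉_ to _∉ˢ_)
open import Data.Fin.Subset.Properties
  using (∣p∣≤n; ∣⊥∣≡0; ∉⊥; ∪-identityˡ; x∈⁅x⁆; x∈⁅y⁆⇒x≡y; x∈p∪q⁻; x∈p∪q⁺)
open import Data.List.Base as List using (List; []; _∷_; _++_; filter; length)
open import Data.List.Membership.Propositional using (_∈_; _∉_)
open import Data.List.Membership.Propositional.Properties using (∈-tabulate⁻; ∈-map⁻)
import Data.List.Properties as List
open import Data.List.Relation.Unary.All as All using (_∷_)
open import Data.List.Relation.Unary.AllPairs using (_∷_)
open import Data.List.Relation.Unary.Any as Any using (here; there)
open import Data.List.Relation.Unary.Unique.Propositional using (Unique)
import Data.List.Relation.Unary.Unique.Propositional.Properties as Unique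
open import Data.Nat.Base as ℕ using (ℕ; zero; suc; _∸_; _⊓_; _⊔_; z≤n; s≤s)
open import Data.Nat.Combinatorics using (_C_; nCk+nC[k+1]≡[n+1]C[k+1]; k>n⇒nCk≡0)
import Data.Nat.Properties as ℕ
open import Data.Nat.Solver using (module +-*-Solver)
open import Data.Product.Base using (Σ-syntax; ∃; _×_; _,_; proj₁; proj₂)
open import Data.Sum.Base using (inj₁; inj₂; [_,_]′)
open import Data.Vec.Base as Vec using (Vec; []; _∷_; lookup; insertAt; here; there)
open import Data.Vec.Properties using (lookup-map; ≡-dec)
open import Function.Base using (_∘_; id)
open import Level using (0ℓ)
open import Relation.Binary.Bundles using (Poset)
open import Relation.Binary.Definitions using (tri<; tri≈; tri>)
open import Relation.Binary.PropositionalEquality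
  using (_≡_; _≢_; refl; sym; trans; cong; cong₂; subst; subst₂; module ≡-Reasoning)
import Relation.Binary.Reasoning.PartialOrder as PosetReasoning
open import Relation.Binary.Structures using (IsDecTotalOrder)
open import Relation.Nullary.Decidable
  using (Dec; yes; no; does; dec-true; dec-false; _×-dec_)
open import Relation.Nullary.Negation using (¬_; contradiction)
open import Relation.Unary using (Pred; Decidable)
open import Algebra.Properties.Semiring.Sum ℕ.+-*-semiring using (sum; ∑-distrib-+)

open OrderedGraph using (size; Adj)

-- The larger star need not fit into t vertices, so C(t, h i) / C(n, h i) cannot serve as the
-- deletion factor of both colours: it may even read 0 / 0. The deletions are therefore counted in
-- natural numbers by `survivors`, with truncated subtraction, and division takes place only at the
-- end, by a binomial known to be positive. For the first bound this is where R ≤ t enters, since R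
-- is at least the size of the smaller star. The expectation is a recursive weighted average over
-- the edge list, so independence is built into its definition. What has to be proved is that a
-- vertex set admits only one possible copy, which fixes in advance the edges that must receive the
-- colour. The minimum has to be exhibited together with a point attaining it. The derivative has an
-- explicit Lipschitz constant, so the supremum axiom alone produces its zero. Differences mostly
-- enter as nonnegative variables, which turns the identities into semiring identities that the
-- solver decides.

module Copies where

  open import Data.Nat.Base using (_+_; _*_; _≤_)

  -- Counting subsets by recursive sums, and binomial identities.

  indicator : Bool → ℕ
  indicator b = if b then 1 else 0

  subsetSum : ∀ n → (Subset n → ℕ) → ℕ
  subsetSum zero    F = F []
  subsetSum (suc n) F = subsetSum n (F ∘ (outside ∷_)) + subsetSum n (F ∘ (inside ∷_))

  subsetSum-cong : ∀ n {F G : Subset n → ℕ} → (∀ S → F S ≡ G S) → subsetSum n F ≡ subsetSum n G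
  subsetSum-cong zero    F≡G = F≡G []
  subsetSum-cong (suc n) F≡G =
    cong₂ _+_ (subsetSum-cong n (F≡G ∘ (outside ∷_))) (subsetSum-cong n (F≡G ∘ (inside ∷_)))

  subsetSum-mono : ∀ n {F G : Subset n → ℕ} → (∀ S → F S ≤ G S) → subsetSum n F ≤ subsetSum n G
  subsetSum-mono zero    F≤G = F≤G []
  subsetSum-mono (suc n) F≤G =
    ℕ.+-mono-≤ (subsetSum-mono n (F≤G ∘ (outside ∷_))) (subsetSum-mono n (F≤G ∘ (inside ∷_)))

  subsetSum-+ : ∀ n (F G : Subset n → ℕ) →
    subsetSum n (λ S → F S + G S) ≡ subsetSum n F + subsetSum n G
  subsetSum-+ zero    F G = refl
  subsetSum-+ (suc n) F G = trans
    (cong₂ _+_ (subsetSum-+ n (F ∘ (outside ∷_)) (G ∘ (outside ∷_)))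
               (subsetSum-+ n (F ∘ (inside ∷_)) (G ∘ (inside ∷_))))
    (solve 4 (λ a b c d → a :+ b :+ (c :+ d) := a :+ c :+ (b :+ d)) refl
       (subsetSum n (F ∘ (outside ∷_))) (subsetSum n (G ∘ (outside ∷_)))
       (subsetSum n (F ∘ (inside ∷_))) (subsetSum n (G ∘ (inside ∷_))))
    where open +-*-Solver

  subsetSum-* : ∀ n k (F : Subset n → ℕ) → subsetSum n (λ S → k * F S) ≡ k * subsetSum n F
  subsetSum-* zero    k F = refl
  subsetSum-* (suc n) k F = trans
    (cong₂ _+_ (subsetSum-* n k (F ∘ (outside ∷_))) (subsetSum-* n k (F ∘ (inside ∷_))))
    (sym (ℕ.*-distribˡ-+ k (subsetSum n (F ∘ (outside ∷_))) (subsetSum n (F ∘ (inside ∷_)))))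

  subsetSum-zero : ∀ n → subsetSum n (λ _ → 0) ≡ 0
  subsetSum-zero zero    = refl
  subsetSum-zero (suc n) = cong₂ _+_ (subsetSum-zero n) (subsetSum-zero n)

  length-filter-map : ∀ {A B : Set} {P : Pred B 0ℓ} (P? : Decidable P) (f : A → B) xs →
    length (filter P? (List.map f xs)) ≡ length (filter (P? ∘ f) xs)
  length-filter-map P? f []       = refl
  length-filter-map P? f (x ∷ xs) with does (P? (f x))
  ... | true  = cong suc (length-filter-map P? f xs)
  ... | false = length-filter-map P? f xs

  length-filter-subsets : ∀ n {P : Pred (Subset n) 0ℓ} (P? : Decidable P) →
    length (filter P? (subsets n)) ≡ subsetSum n (λ S → indicator (does (P? S)))
  length-filter-subsets zero P? with does (P? [])
  ... | true  = refl
  ... | false = refl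
  length-filter-subsets (suc n) P? = begin
    length (filter P? (List.map (outside ∷_) (subsets n) ++ List.map (inside ∷_) (subsets n)))
      ≡⟨ cong length (List.filter-++ P? (List.map (outside ∷_) (subsets n)) _) ⟩
    length (filter P? (List.map (outside ∷_) (subsets n)) ++
            filter P? (List.map (inside ∷_) (subsets n)))
      ≡⟨ List.length-++ (filter P? (List.map (outside ∷_) (subsets n))) ⟩
    length (filter P? (List.map (outside ∷_) (subsets n))) +
    length (filter P? (List.map (inside ∷_) (subsets n)))
      ≡⟨ cong₂ _+_ (length-filter-map P? _ (subsets n)) (length-filter-map P? _ (subsets n)) ⟩
    length (filter (P? ∘ (outside ∷_)) (subsets n)) + length (filter (P? ∘ (inside ∷_)) (subsets n))
      ≡⟨ cong₂ _+_ (length-filter-subsets n _) (length-filter-subsets n _) ⟩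
    subsetSum (suc n) (λ S → indicator (does (P? S))) ∎
    where open ≡-Reasoning

  -- Splitting by membership of the first vertex is Pascal's rule.
  subsetSum-∣∣≡ : ∀ n k → subsetSum n (λ S → indicator (does (∣ S ∣ ℕ.≟ k))) ≡ n C k
  subsetSum-∣∣≡ zero zero = refl
  subsetSum-∣∣≡ zero (suc k) = sym (k>n⇒nCk≡0 (s≤s (z≤n {k})))
  subsetSum-∣∣≡ (suc n) zero = cong₂ _+_ (subsetSum-∣∣≡ n zero) (subsetSum-zero n)
  subsetSum-∣∣≡ (suc n) (suc k) = begin
    subsetSum n (λ S → indicator (does (∣ S ∣ ℕ.≟ suc k))) +
    subsetSum n (λ S → indicator (does (∣ S ∣ ℕ.≟ k)))
      ≡⟨ cong₂ _+_ (subsetSum-∣∣≡ n (suc k)) (subsetSum-∣∣≡ n k) ⟩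
    n C suc k + n C k ≡⟨ ℕ.+-comm (n C suc k) (n C k) ⟩
    n C k + n C suc k ≡⟨ nCk+nC[k+1]≡[n+1]C[k+1] n k ⟩
    suc n C suc k     ∎
    where open ≡-Reasoning

  -- A subset S of Fin (n + 1) arises by inserting one absent element in
  -- n + 1 - |S| ways.
  sum-subsetSum-insertAt : ∀ n (F : Subset (suc n) → ℕ) →
    sum {suc n} (λ v → subsetSum n (λ S → F (insertAt S v outside))) ≡
    subsetSum (suc n) (λ S → (suc n ∸ ∣ S ∣) * F S)
  sum-subsetSum-insertAt zero    F = sym (ℕ.+-identityʳ _)
  sum-subsetSum-insertAt (suc n) F = begin
    -- `v = zero` puts the absent element in front and so yields every subset avoiding the first
    -- vertex once; any later position keeps the head of the subset.
    subsetSum (suc n) F₀ + sum {suc n} (λ v → inserted F₀ v + inserted F₁ v)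
      ≡⟨ cong (subsetSum (suc n) F₀ +_) (∑-distrib-+ {suc n} (inserted F₀) (inserted F₁)) ⟩
    subsetSum (suc n) F₀ + (sum (inserted F₀) + sum (inserted F₁))
      ≡⟨ cong (subsetSum (suc n) F₀ +_)
           (cong₂ _+_ (sum-subsetSum-insertAt n F₀) (sum-subsetSum-insertAt n F₁)) ⟩
    subsetSum (suc n) F₀ + (subsetSum (suc n) (weighted F₀) + subsetSum (suc n) (weighted F₁))
      ≡⟨ ℕ.+-assoc (subsetSum (suc n) F₀) _ _ ⟨
    subsetSum (suc n) F₀ + subsetSum (suc n) (weighted F₀) + subsetSum (suc n) (weighted F₁)
      -- The extra sum of `F₀` raises the coefficient of each subset avoiding the first vertex by
      -- one; `∣p∣≤n` keeps the truncated subtraction exact.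
      ≡⟨ cong (_+ subsetSum (suc n) (weighted F₁))
           (trans (sym (subsetSum-+ (suc n) F₀ (weighted F₀)))
                  (subsetSum-cong (suc n) λ S → cong (_* F₀ S) (sym (ℕ.+-∸-assoc 1 (∣p∣≤n S))))) ⟩
    subsetSum (suc (suc n)) (λ S → (suc (suc n) ∸ ∣ S ∣) * F S) ∎
    where
    open ≡-Reasoning

    F₀ F₁ : Subset (suc n) → ℕ
    F₀ = F ∘ (outside ∷_)
    F₁ = F ∘ (inside ∷_)

    inserted : (Subset (suc n) → ℕ) → Fin (suc n) → ℕ
    inserted G v = subsetSum n (λ S → G (insertAt S v outside))

    weighted : (Subset (suc n) → ℕ) → Subset (suc n) → ℕ
    weighted G S = (suc n ∸ ∣ S ∣) * G S

  -- Both sides count pairs of a k-subset of n + 1 points and a point outside it. For k > n both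
  -- vanish, so no bound on k is assumed.
  [1+n]Ck*[1+n∸k]≡[1+n]*nCk : ∀ n k → (suc n C k) * (suc n ∸ k) ≡ suc n * (n C k)
  [1+n]Ck*[1+n∸k]≡[1+n]*nCk n zero = ℕ.*-comm 1 (suc n)
  [1+n]Ck*[1+n∸k]≡[1+n]*nCk zero (suc k) =
    trans (trans (cong ((1 C suc k) *_) (ℕ.0∸n≡0 k)) (ℕ.*-zeroʳ (1 C suc k)))
          (sym (cong (1 *_) (k>n⇒nCk≡0 {0} {suc k} (s≤s z≤n))))
  [1+n]Ck*[1+n∸k]≡[1+n]*nCk (suc n) (suc k) with k ℕ.≤? n
  ... | no k≰n = trans
    (trans (cong ((suc (suc n) C suc k) *_) (ℕ.m≤n⇒m∸n≡0 (ℕ.≰⇒> k≰n)))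
           (ℕ.*-zeroʳ (suc (suc n) C suc k)))
    (sym (trans (cong (suc (suc n) *_) (k>n⇒nCk≡0 {suc n} {suc k} (s≤s (ℕ.≰⇒> k≰n))))
                (ℕ.*-zeroʳ (suc (suc n)))))
  ... | yes k≤n = begin
    (suc (suc n) C suc k) * (suc n ∸ k)
      ≡⟨ cong (_* (suc n ∸ k)) (nCk+nC[k+1]≡[n+1]C[k+1] (suc n) k) ⟨
    (suc n C k + suc n C suc k) * (suc n ∸ k)
      ≡⟨ ℕ.*-distribʳ-+ (suc n ∸ k) (suc n C k) (suc n C suc k) ⟩
    (suc n C k) * (suc n ∸ k) + (suc n C suc k) * (suc n ∸ k)
      ≡⟨ cong₂ _+_ ([1+n]Ck*[1+n∸k]≡[1+n]*nCk n k)
           (trans (cong ((suc n C suc k) *_) (ℕ.+-∸-assoc 1 k≤n))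
                  (ℕ.*-suc (suc n C suc k) (n ∸ k))) ⟩
    suc n * (n C k) + (suc n C suc k + (suc n C suc k) * (suc n ∸ suc k))
      ≡⟨ cong (λ z → suc n * (n C k) + (suc n C suc k + z))
           ([1+n]Ck*[1+n∸k]≡[1+n]*nCk n (suc k)) ⟩
    suc n * (n C k) + (suc n C suc k + suc n * (n C suc k))
      ≡⟨ solve 4 (λ m a b c → m :* a :+ (c :+ m :* b) := c :+ m :* (a :+ b)) refl
           (suc n) (n C k) (n C suc k) (suc n C suc k) ⟩
    suc n C suc k + suc n * (n C k + n C suc k)
      ≡⟨ cong (λ z → suc n C suc k + suc n * z) (nCk+nC[k+1]≡[n+1]C[k+1] n k) ⟩
    suc (suc n) * (suc n C suc k) ∎
    where
    open ≡-Reasoning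
    open +-*-Solver

  0<nCk : ∀ {n k} → k ≤ n → 1 ≤ n C k
  0<nCk {n} {zero} _ = s≤s z≤n
  0<nCk {suc n} {suc k} (s≤s k≤n) = subst (1 ≤_) (nCk+nC[k+1]≡[n+1]C[k+1] n k)
    (ℕ.≤-trans (0<nCk k≤n) (ℕ.m≤m+n (n C k) (n C suc k)))

  -- Vertex sets of increasing tuples.

  Mono : ∀ {m n} → Vec (Fin n) m → Set
  Mono f = ∀ u v → u Fin.< v → lookup f u Fin.< lookup f v

  mono-tail : ∀ {m n} {x : Fin n} {f : Vec (Fin n) m} → Mono (x ∷ f) → Mono f
  mono-tail mono u v u<v = mono (suc u) (suc v) (s≤s u<v)

  ∈-vertexSet⁺ : ∀ {m n} (f : Vec (Fin n) m) j → lookup f j ∈ˢ vertexSet f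
  ∈-vertexSet⁺ (x ∷ f) zero    = x∈p∪q⁺ (inj₁ (x∈⁅x⁆ x))
  ∈-vertexSet⁺ (x ∷ f) (suc j) = x∈p∪q⁺ (inj₂ (∈-vertexSet⁺ f j))

  ∈-vertexSet⁻ : ∀ {m n} (f : Vec (Fin n) m) {x} → x ∈ˢ vertexSet f → ∃ λ j → x ≡ lookup f j
  ∈-vertexSet⁻ []      x∈ = contradiction x∈ ∉⊥
  ∈-vertexSet⁻ (y ∷ f) x∈ with x∈p∪q⁻ ⁅ y ⁆ (vertexSet f) x∈
  ... | inj₁ x∈y = zero , x∈⁅y⁆⇒x≡y y x∈y
  ... | inj₂ x∈f with j , x≡ ← ∈-vertexSet⁻ f x∈f = suc j , x≡

  ∣⁅x⁆∪p∣ : ∀ {n} (x : Fin n) {p} → x ∉ˢ p → ∣ ⁅ x ⁆ ∪ p ∣ ≡ suc ∣ p ∣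
  ∣⁅x⁆∪p∣ zero    {inside  ∷ p} x∉p = contradiction here x∉p
  ∣⁅x⁆∪p∣ zero    {outside ∷ p} x∉p = cong (suc ∘ ∣_∣) (∪-identityˡ p)
  ∣⁅x⁆∪p∣ (suc x) {inside  ∷ p} x∉p = cong suc (∣⁅x⁆∪p∣ x (x∉p ∘ there))
  ∣⁅x⁆∪p∣ (suc x) {outside ∷ p} x∉p = ∣⁅x⁆∪p∣ x (x∉p ∘ there)

  ∣vertexSet∣ : ∀ {m n} (f : Vec (Fin n) m) → Mono f → ∣ vertexSet f ∣ ≡ m
  ∣vertexSet∣ {n = n} [] mono = ∣⊥∣≡0 n
  ∣vertexSet∣ (x ∷ f) mono = trans (∣⁅x⁆∪p∣ x x∉f) (cong suc (∣vertexSet∣ f (mono-tail mono)))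
    where
    x∉f : x ∉ˢ vertexSet f
    x∉f x∈f with j , x≡ ← ∈-vertexSet⁻ f x∈f = Fin.<⇒≢ (mono zero (suc j) (s≤s z≤n)) x≡

  mono-unique : ∀ {m n} (f g : Vec (Fin n) m) → Mono f → Mono g →
    (∀ j → ∃ λ k → lookup f j ≡ lookup g k) → (∀ k → ∃ λ j → lookup g k ≡ lookup f j) → f ≡ g
  mono-unique [] [] _ _ _ _ = refl
  mono-unique {n = n} (x ∷ f) (y ∷ g) mf mg f⊆g g⊆f =
    cong₂ _∷_ x≡y (mono-unique f g (mono-tail mf) (mono-tail mg)
                     (tail-⊆ f g mf x≡y f⊆g) (tail-⊆ g f mg (sym x≡y) g⊆f))
    where
    x≡y : x ≡ y
    x≡y with f⊆g zero | g⊆f zero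
    ... | zero  , x≡y | _           = x≡y
    ... | suc _ , _   | zero  , y≡x = sym y≡x
    -- Each head would occur strictly later in the other tuple, hence be larger than the other head.
    ... | suc k , x≡  | suc j , y≡  = contradiction
      (subst₂ Fin._<_ refl (sym x≡) (mg zero (suc k) (s≤s z≤n)))
      (Fin.<-asym (subst₂ Fin._<_ refl (sym y≡) (mf zero (suc j) (s≤s z≤n))))

    tail-⊆ : ∀ {m x y} (f g : Vec (Fin n) m) → Mono (x ∷ f) → x ≡ y →
      (∀ j → ∃ λ k → lookup (x ∷ f) j ≡ lookup (y ∷ g) k) → ∀ j → ∃ λ k → lookup f j ≡ lookup g k
    tail-⊆ f g mf x≡y f⊆g j with f⊆g (suc j)
    ... | suc k , eq = k , eq
    ... | zero  , eq = contradiction (trans x≡y (sym eq)) (Fin.<⇒≢ (mf zero (suc j) (s≤s z≤n)))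

  -- A set has only one increasing enumeration. The expectation relies on this to name the edges of
  -- a copy before any colour is drawn.
  vertexSet-injective : ∀ {m n} (f g : Vec (Fin n) m) → Mono f → Mono g →
    vertexSet f ≡ vertexSet g → f ≡ g
  vertexSet-injective f g mf mg eq = mono-unique f g mf mg
    (λ j → ∈-vertexSet⁻ g (subst (lookup f j ∈ˢ_) eq (∈-vertexSet⁺ f j)))
    (λ k → ∈-vertexSet⁻ f (subst (lookup g k ∈ˢ_) (sym eq) (∈-vertexSet⁺ g k)))

  hasCopyOn⇒∣∣≡size : ∀ {n} {χ : Coloring n} {i H S} → HasCopyOn χ i H S → ∣ S ∣ ≡ size H
  hasCopyOn⇒∣∣≡size (f , (c , _) , refl) = ∣vertexSet∣ f (IsCopy.mono c)

  -- Deleting a vertex.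

  insertAt-⊥ : ∀ {n} (v : Fin (suc n)) → insertAt ⊥ v outside ≡ ⊥
  insertAt-⊥ {n}     zero    = refl
  insertAt-⊥ {suc n} (suc v) = cong (outside ∷_) (insertAt-⊥ v)

  insertAt-⁅⁆ : ∀ {n} (v : Fin (suc n)) x → insertAt ⁅ x ⁆ v outside ≡ ⁅ punchIn v x ⁆
  insertAt-⁅⁆ zero    x       = refl
  insertAt-⁅⁆ (suc v) zero    = cong (inside ∷_) (insertAt-⊥ v)
  insertAt-⁅⁆ (suc v) (suc x) = cong (outside ∷_) (insertAt-⁅⁆ v x)

  insertAt-∪ : ∀ {n} (v : Fin (suc n)) (p q : Subset n) →
    insertAt (p ∪ q) v outside ≡ insertAt p v outside ∪ insertAt q v outside
  insertAt-∪ zero    p       q       = refl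
  insertAt-∪ (suc v) (x ∷ p) (y ∷ q) = cong (_ ∷_) (insertAt-∪ v p q)

  vertexSet-punchIn : ∀ {m n} (v : Fin (suc n)) (f : Vec (Fin n) m) →
    vertexSet (Vec.map (punchIn v) f) ≡ insertAt (vertexSet f) v outside
  vertexSet-punchIn v []      = sym (insertAt-⊥ v)
  vertexSet-punchIn v (x ∷ f) = trans (cong₂ _∪_ (sym (insertAt-⁅⁆ v x)) (vertexSet-punchIn v f))
                                      (sym (insertAt-∪ v ⁅ x ⁆ (vertexSet f)))

  punchIn-mono-< : ∀ {n} (v : Fin (suc n)) {x y : Fin n} → x Fin.< y → punchIn v x Fin.< punchIn v y
  punchIn-mono-< v {x} {y} x<y = ℕ.≰⇒> λ le → ℕ.<⇒≱ x<y (Fin.punchIn-cancel-≤ v y x le)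

  adj-𝒦⁺ : ∀ {n} {x y : Fin n} → x ≢ y → Adj (𝒦 n) x y
  adj-𝒦⁺ {x = x} {y} x≢y with x Fin.≟ y
  ... | yes x≡y = x≢y x≡y
  ... | no  _   = _

  adj-𝒦⁻ : ∀ {n} {x y : Fin n} → Adj (𝒦 n) x y → x ≢ y
  adj-𝒦⁻ {x = x} {y} x~y with x Fin.≟ y
  ... | no x≢y = x≢y

  deleteVertex : ∀ {n} → Fin (suc n) → Coloring (suc n) → Coloring n
  deleteVertex v χ (edge x y x<y x~y) =
    χ (edge (punchIn v x) (punchIn v y) (punchIn-mono-< v x<y)
            (adj-𝒦⁺ (adj-𝒦⁻ x~y ∘ Fin.punchIn-injective v x y)))

  -- Order and adjacency proofs are irrelevant, so the colour depends on the ends alone. This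
  -- carries colours across the merely propositional equation `lookup-map`.
  coloring-cong : ∀ {n} (χ : Coloring n) {x x′ y y′}
    .{x<y : x Fin.< y} .{x′<y′ : x′ Fin.< y′}
    .{x~y : Adj (𝒦 n) x y} .{x′~y′ : Adj (𝒦 n) x′ y′} →
    x ≡ x′ → y ≡ y′ → χ (edge x y x<y x~y) ≡ χ (edge x′ y′ x′<y′ x′~y′)
  coloring-cong χ refl refl = refl

  -- `punchIn v` preserves order and colours by construction of `deleteVertex`. This one implication
  -- gives the averaging inequality its direction.
  hasCopyOn-deleteVertex : ∀ {n} v (χ : Coloring (suc n)) {i H S} →
    HasCopyOn (deleteVertex v χ) i H S → HasCopyOn χ i H (insertAt S v outside)
  hasCopyOn-deleteVertex {n} v χ {i} {H} (f , (c , mono) , refl) =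
    f′ , (copy′ , mono-color) , vertexSet-punchIn v f
    where
    f′ : Vec (Fin (suc n)) (size H)
    f′ = Vec.map (punchIn v) f

    f′≡ : ∀ x → lookup f′ x ≡ punchIn v (lookup f x)
    f′≡ x = lookup-map x (punchIn v) f

    mono′ : Mono f′
    mono′ x y x<y = subst₂ Fin._<_ (sym (f′≡ x)) (sym (f′≡ y))
      (punchIn-mono-< v (IsCopy.mono c x y x<y))

    adj′ : ∀ x y → Adj H x y → Adj (𝒦 (suc n)) (lookup f′ x) (lookup f′ y)
    adj′ x y x~y = subst₂ (Adj (𝒦 (suc n))) (sym (f′≡ x)) (sym (f′≡ y))
      (adj-𝒦⁺ (adj-𝒦⁻ (IsCopy.adj c x y x~y) ∘ Fin.punchIn-injective v _ _))

    copy′ : IsCopy H (𝒦 (suc n)) f′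
    copy′ = isCopy mono′ adj′

    mono-color : ∀ e → χ (mapEdge {f = f′} copy′ e) ≡ i
    mono-color e@(edge x y _ _) = trans (coloring-cong χ (f′≡ x) (f′≡ y)) (mono e)

  indicator-mono : ∀ {P Q : Set} (P? : Dec P) (Q? : Dec Q) → (P → Q) →
    indicator (does P?) ≤ indicator (does Q?)
  indicator-mono (no _)  _       P⇒Q = z≤n
  indicator-mono (yes _) (yes _) P⇒Q = ℕ.≤-refl
  indicator-mono (yes p) (no ¬q) P⇒Q = contradiction (P⇒Q p) ¬q

  sum-mono : ∀ {n} {f g : Fin n → ℕ} → (∀ v → f v ≤ g v) → sum f ≤ sum g
  sum-mono {zero}  f≤g = z≤n
  sum-mono {suc n} f≤g = ℕ.+-mono-≤ (f≤g zero) (sum-mono (f≤g ∘ suc))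

  -- Each copy survives the deletion of every vertex outside it.
  sum-copies-deleteVertex : ∀ {n} (χ : Coloring (suc n)) i H →
    sum (λ v → copies (deleteVertex v χ) i H) ≤ (suc n ∸ size H) * copies χ i H
  sum-copies-deleteVertex {n} χ i H = begin
    sum (λ v → copies (deleteVertex v χ) i H)
      ≤⟨ sum-mono (λ v → ℕ.≤-trans
           (ℕ.≤-reflexive (length-filter-subsets n (hasCopyOn? (deleteVertex v χ) i H)))
           (subsetSum-mono n λ S → indicator-mono (hasCopyOn? (deleteVertex v χ) i H S)
              (hasCopyOn? χ i H (insertAt S v outside)) (hasCopyOn-deleteVertex v χ {i} {H}))) ⟩
    sum {suc n} (λ v → subsetSum n (λ S → F (insertAt S v outside)))
      ≡⟨ sum-subsetSum-insertAt n F ⟩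
    subsetSum (suc n) (λ S → (suc n ∸ ∣ S ∣) * F S)
      -- A subset carrying a copy has exactly `size H` elements, and on all others `F` is 0, so the
      -- coefficient may be made constant.
      ≡⟨ subsetSum-cong (suc n) size≡ ⟩
    subsetSum (suc n) (λ S → (suc n ∸ size H) * F S)
      ≡⟨ subsetSum-* (suc n) (suc n ∸ size H) F ⟩
    (suc n ∸ size H) * subsetSum (suc n) F
      ≡⟨ cong ((suc n ∸ size H) *_) (length-filter-subsets (suc n) (hasCopyOn? χ i H)) ⟨
    (suc n ∸ size H) * copies χ i H ∎
    where
    open ℕ.≤-Reasoning

    F : Subset (suc n) → ℕ
    F S = indicator (does (hasCopyOn? χ i H S))

    size≡ : ∀ S → (suc n ∸ ∣ S ∣) * F S ≡ (suc n ∸ size H) * F S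
    size≡ S with hasCopyOn? χ i H S
    ... | yes copy = cong (λ k → (suc n ∸ k) * 1) (hasCopyOn⇒∣∣≡size {χ = χ} {i} {H} copy)
    ... | no  _    = trans (ℕ.*-zeroʳ (suc n ∸ ∣ S ∣)) (sym (ℕ.*-zeroʳ (suc n ∸ size H)))

open Copies

-- Edges of stars and of their copies.

starEdges : ∀ r s → 1 ℕ.≤ r → 1 ℕ.≤ s →
  Σ[ L ∈ List (Edge (𝒮 r s)) ] Unique L × length L ≡ r ℕ.+ s ℕ.∸ 2
-- From here on `r` and `s` are the numbers of left and right leaves, so the centre is vertex `r`.
-- Distinctness and length of `L` provide the exponent e of the expectation, one independent factor
-- per edge.
starEdges (suc r) (suc s) _ _ = L , unique , length≡
  where
  c : Fin (r ℕ.+ suc s)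
  c = r ↑ʳ zero

  toℕ-c : toℕ c ≡ r
  toℕ-c = trans (Fin.toℕ-↑ʳ r zero) (ℕ.+-identityʳ r)

  leaf<c : ∀ (u : Fin r) → u ↑ˡ suc s Fin.< c
  leaf<c u = subst₂ ℕ._<_ (sym (Fin.toℕ-↑ˡ u (suc s))) (sym toℕ-c) (Fin.toℕ<n u)

  c<leaf : ∀ (v : Fin s) → c Fin.< r ↑ʳ suc v
  c<leaf v = subst₂ ℕ._<_ (sym (Fin.toℕ-↑ʳ r zero)) (sym (Fin.toℕ-↑ʳ r (suc v)))
                    (ℕ.+-monoʳ-< r (s≤s z≤n))

  xor-adj : ∀ {A B : Set} (A? : Dec A) (B? : Dec B) → A → ¬ B → T (does A? xor does B?)
  xor-adj A? B? a ¬b rewrite dec-true A? a | dec-false B? ¬b = _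

  xor-adj′ : ∀ {A B : Set} (A? : Dec A) (B? : Dec B) → ¬ A → B → T (does A? xor does B?)
  xor-adj′ A? B? ¬a b rewrite dec-true B? b | dec-false A? ¬a = _

  left : Fin r → Edge (𝒮 (suc r) (suc s))
  left u = edge (u ↑ˡ suc s) c (leaf<c u)
    (xor-adj′ (toℕ (u ↑ˡ suc s) ℕ.≟ r) (toℕ c ℕ.≟ r)
              (λ eq → ℕ.<⇒≢ (leaf<c u) (trans eq (sym toℕ-c))) toℕ-c)

  right : Fin s → Edge (𝒮 (suc r) (suc s))
  right v = edge c (r ↑ʳ suc v) (c<leaf v)
    (xor-adj (toℕ c ℕ.≟ r) (toℕ (r ↑ʳ suc v) ℕ.≟ r) toℕ-c
             (λ eq → ℕ.<⇒≢ (c<leaf v) (trans toℕ-c (sym eq))))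

  L : List (Edge (𝒮 (suc r) (suc s)))
  L = List.tabulate left ++ List.tabulate right

  unique : Unique L
  unique = Unique.++⁺
    (Unique.tabulate⁺ {f = left} (Fin.↑ˡ-injective (suc s) _ _ ∘ cong Edge.left))
    (Unique.tabulate⁺ {f = right} (Fin.suc-injective ∘ Fin.↑ʳ-injective r _ _ ∘ cong Edge.right))
    -- The left end of an edge in `left` lies before the centre, that of an edge in `right` is the
    -- centre.
    λ (e∈left , e∈right) → let u , e≡left = ∈-tabulate⁻ e∈left
                               v , e≡right = ∈-tabulate⁻ e∈right
                           in Fin.<⇒≢ (leaf<c u) (cong Edge.left (trans (sym e≡left) e≡right))

  length≡ : length L ≡ suc r ℕ.+ suc s ℕ.∸ 2
  length≡ = begin
    length L
      ≡⟨ List.length-++ (List.tabulate left) ⟩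
    length (List.tabulate left) ℕ.+ length (List.tabulate right)
      ≡⟨ cong₂ ℕ._+_ (List.length-tabulate left) (List.length-tabulate right) ⟩
    r ℕ.+ s
      ≡⟨ cong (ℕ._∸ 1) (ℕ.+-suc r s) ⟨
    r ℕ.+ suc s ℕ.∸ 1 ∎
    where open ≡-Reasoning

mono⇒injective : ∀ {m n} (f : Vec (Fin n) m) → Mono f →
  ∀ {u v} → lookup f u ≡ lookup f v → u ≡ v
mono⇒injective f mono {u} {v} eq with Fin.<-cmp u v
... | tri< u<v _ _ = contradiction eq (Fin.<⇒≢ (mono u v u<v))
... | tri≈ _ u≡v _ = u≡v
... | tri> _ _ v<u = contradiction (sym eq) (Fin.<⇒≢ (mono v u v<u))

mapEdge-injective : ∀ {H G f} (c : IsCopy H G f) {e e′} → mapEdge c e ≡ mapEdge c e′ → e ≡ e′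
mapEdge-injective {f = f} c {edge u v _ _} {edge u′ v′ _ _} eq
  with refl ← mono⇒injective f (IsCopy.mono c) {u} {u′} (cong Edge.left eq)
     | refl ← mono⇒injective f (IsCopy.mono c) {v} {v′} (cong Edge.right eq) = refl

-- Used when an edge of the event is drawn: exactly one factor is split off, and because the list
-- had no repetition, the remaining event no longer mentions that edge.
record Removal {A : Set} (x : A) (xs : List A) : Set where
  field
    rest    : List A
    unique  : Unique rest
    length≡ : length xs ≡ suc (length rest)
    x∉rest  : x ∉ rest
    rest⊆   : ∀ {y} → y ∈ rest → y ∈ xs

remove : ∀ {A : Set} {x : A} {xs} → Unique xs → x ∈ xs → Removal x xs
remove {xs = y ∷ xs} (y∉ ∷ unique) (here refl) = record
  { rest    = xs
  ; unique  = unique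
  ; length≡ = refl
  ; x∉rest  = λ y∈ → All.lookup y∉ y∈ refl
  ; rest⊆   = there
  }
remove {x = x} {xs = y ∷ xs} (y∉ ∷ unique) (there x∈) = record
  { rest    = y ∷ R.rest
  ; unique  = All.tabulate (λ z∈ → All.lookup y∉ (R.rest⊆ z∈)) ∷ R.unique
  ; length≡ = cong suc R.length≡
  ; x∉rest  = λ { (here x≡y) → All.lookup y∉ x∈ (sym x≡y) ; (there x∈′) → R.x∉rest x∈′ }
  ; rest⊆   = λ { (here eq) → here eq ; (there z∈) → there (R.rest⊆ z∈) }
  }
  where module R = Removal (remove unique x∈)

paint-≡ : ∀ {n} (e : Edge (𝒦 n)) i χ → paint e i χ e ≡ i
paint-≡ e i χ with e ≟ᴱ e
... | yes _  = refl
... | no e≢e = contradiction refl e≢e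

paint-≢ : ∀ {n} (e : Edge (𝒦 n)) {e′} i χ → e′ ≢ e → paint e i χ e′ ≡ χ e′
paint-≢ e {e′} i χ e′≢e with e ≟ᴱ e′
... | yes e≡e′ = contradiction (sym e≡e′) e′≢e
... | no _     = refl

-- Deletion counts and binomial ratios.

-- The number of ways to delete d of d + t points one after another while
-- sparing k given ones.
survivors : ℕ → ℕ → ℕ → ℕ
survivors k t zero    = 1
survivors k t (suc d) = (suc (d ℕ.+ t) ∸ k) ℕ.* survivors k t d

-- With `C*survivors` this is the monotonicity of C(t, k) / C(d + t, k) in k, freed of denominators
-- and valid also where these vanish.
survivors-antimono : ∀ {k l} t d → k ℕ.≤ l → survivors l t d ℕ.≤ survivors k t d
survivors-antimono t zero    k≤l = ℕ.≤-refl
survivors-antimono t (suc d) k≤l =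
  ℕ.*-mono-≤ (ℕ.∸-monoʳ-≤ (suc (d ℕ.+ t)) k≤l) (survivors-antimono t d k≤l)

survivors₀-pos : ∀ t d → 1 ℕ.≤ survivors 0 t d
survivors₀-pos t zero    = ℕ.≤-refl
survivors₀-pos t (suc d) = ℕ.*-mono-≤ {1} {suc (d ℕ.+ t)} (s≤s z≤n) (survivors₀-pos t d)

-- The identity `[1+n]Ck*[1+n∸k]≡[1+n]*nCk` telescopes from t up to d + t.
C*survivors : ∀ k t d → ((d ℕ.+ t) C k) ℕ.* survivors k t d ≡ survivors 0 t d ℕ.* (t C k)
C*survivors k t zero    = ℕ.*-comm (t C k) 1
C*survivors k t (suc d) = begin
  (suc n C k) ℕ.* ((suc n ∸ k) ℕ.* survivors k t d)
    ≡⟨ ℕ.*-assoc (suc n C k) (suc n ∸ k) (survivors k t d) ⟨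
  (suc n C k) ℕ.* (suc n ∸ k) ℕ.* survivors k t d
    ≡⟨ cong (ℕ._* survivors k t d) ([1+n]Ck*[1+n∸k]≡[1+n]*nCk n k) ⟩
  suc n ℕ.* (n C k) ℕ.* survivors k t d
    ≡⟨ ℕ.*-assoc (suc n) (n C k) (survivors k t d) ⟩
  suc n ℕ.* ((n C k) ℕ.* survivors k t d)
    ≡⟨ cong (suc n ℕ.*_) (C*survivors k t d) ⟩
  suc n ℕ.* (survivors 0 t d ℕ.* (t C k))
    ≡⟨ ℕ.*-assoc (suc n) (survivors 0 t d) (t C k) ⟨
  suc n ℕ.* survivors 0 t d ℕ.* (t C k) ∎
  where
  open ≡-Reasoning
  n = d ℕ.+ t

-- A single constant colouring suffices: whichever colour is returned, its graph has been embedded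
-- into N vertices. The purpose is that C(t, h⋆) is positive.
arrows⇒⊓size≤ : ∀ {N} (G : Color → OrderedGraph) → Arrows N G →
  size (G red) ⊓ size (G blue) ℕ.≤ N
arrows⇒⊓size≤ {N} G arrows with arrows (λ _ → red)
... | i , f , (c , _) =
  ℕ.≤-trans (⊓≤ i) (subst (ℕ._≤ N) (∣vertexSet∣ f (IsCopy.mono c)) (∣p∣≤n (vertexSet f)))
  where
  ⊓≤ : ∀ i → size (G red) ⊓ size (G blue) ℕ.≤ size (G i)
  ⊓≤ red  = ℕ.m⊓n≤m _ _
  ⊓≤ blue = ℕ.m⊓n≤n (size (G red)) _

module OverReals {c ℓ₁ ℓ₂} (ℝ : CompleteOrderedField c ℓ₁ ℓ₂) where

  open CompleteOrderedField ℝ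
  open Multiplicity ℝ
  open IsDecTotalOrder isDecTotalOrder using (_≤?_; antisym; isPartialOrder)
    renaming (refl to ≤-refl; reflexive to ≤-reflexive; trans to ≤-trans; total to ≤-total)
  open CommutativeRing commutativeRing
    using (semiring; commutativeSemiring; ring; +-abelianGroup; +-cong; +-congˡ; +-congʳ;
           +-comm; +-assoc; +-identityˡ; +-identityʳ; -‿inverseʳ; -‿inverseˡ;
           *-cong; *-congˡ; *-congʳ; *-comm; *-assoc; *-identityˡ; *-identityʳ;
           zeroˡ; zeroʳ; distribʳ; distribˡ)
    renaming (refl to ≈-refl; sym to ≈-sym; trans to ≈-trans; reflexive to ≈-reflexive)
  open RingProperties ring using (-1*x≈-x)
  open Mult semiring using (×-homo-+; ×1-homo-*)
  open SemiringSolver commutativeSemiring using (solve; _:=_; _:+_; _:*_; con)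

  -- Ordered field arithmetic.

  poset : Poset c ℓ₁ ℓ₂
  poset = record { isPartialOrder = isPartialOrder }

  open PosetReasoning poset

  +-mono-≤ : ∀ {x y u v} → x ≤ y → u ≤ v → x + u ≤ y + v
  +-mono-≤ {x} {y} {u} {v} x≤y u≤v = begin
    x + u ≤⟨ +-monoˡ-≤ u x≤y ⟩
    y + u ≈⟨ +-comm y u ⟩
    u + y ≤⟨ +-monoˡ-≤ y u≤v ⟩
    v + y ≈⟨ +-comm v y ⟩
    y + v ∎

  +-monoʳ-≤ : ∀ z {x y} → x ≤ y → z + x ≤ z + y
  +-monoʳ-≤ z = +-mono-≤ ≤-refl

  x+y-y≈x : ∀ x y → x + y - y ≈ x
  x+y-y≈x x y = begin-equality
    x + y - y   ≈⟨ +-assoc x y (- y) ⟩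
    x + (y - y) ≈⟨ +-congˡ (-‿inverseʳ y) ⟩
    x + 0#      ≈⟨ +-identityʳ x ⟩
    x           ∎

  x-y+y≈x : ∀ x y → x - y + y ≈ x
  x-y+y≈x x y = begin-equality
    x - y + y     ≈⟨ +-assoc x (- y) y ⟩
    x + (- y + y) ≈⟨ +-congˡ (-‿inverseˡ y) ⟩
    x + 0#        ≈⟨ +-identityʳ x ⟩
    x             ∎

  y+[x-y]≈x : ∀ x y → y + (x - y) ≈ x
  y+[x-y]≈x x y = ≈-trans (+-comm y (x - y)) (x-y+y≈x x y)

  +-cancelʳ-≤ : ∀ z {x y} → x + z ≤ y + z → x ≤ y
  +-cancelʳ-≤ z {x} {y} le = begin
    x         ≈⟨ x+y-y≈x x z ⟨
    x + z - z ≤⟨ +-monoˡ-≤ (- z) le ⟩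
    y + z - z ≈⟨ x+y-y≈x y z ⟩
    y         ∎

  0≤y-x : ∀ {x y} → x ≤ y → 0# ≤ y - x
  0≤y-x {x} {y} x≤y = begin
    0#    ≈⟨ -‿inverseʳ x ⟨
    x - x ≤⟨ +-monoˡ-≤ (- x) x≤y ⟩
    y - x ∎

  +-nonNeg : ∀ {x y} → 0# ≤ x → 0# ≤ y → 0# ≤ x + y
  +-nonNeg {x} {y} 0≤x 0≤y = begin
    0#      ≈⟨ +-identityˡ 0# ⟨
    0# + 0# ≤⟨ +-mono-≤ 0≤x 0≤y ⟩
    x + y   ∎

  *-monoˡ-≤ : ∀ {z} → 0# ≤ z → ∀ {x y} → x ≤ y → z * x ≤ z * y
  *-monoˡ-≤ {z} 0≤z {x} {y} x≤y = begin
    z * x                 ≈⟨ +-identityʳ _ ⟨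
    z * x + 0#            ≤⟨ +-monoʳ-≤ (z * x) (*-nonNeg 0≤z (0≤y-x x≤y)) ⟩
    z * x + z * (y - x)   ≈⟨ distribˡ z x (y - x) ⟨
    z * (x + (y - x))     ≈⟨ *-congˡ (y+[x-y]≈x y x) ⟩
    z * y                 ∎

  *-monoʳ-≤ : ∀ {z} → 0# ≤ z → ∀ {x y} → x ≤ y → x * z ≤ y * z
  *-monoʳ-≤ {z} 0≤z {x} {y} x≤y = begin
    x * z ≈⟨ *-comm x z ⟩
    z * x ≤⟨ *-monoˡ-≤ 0≤z x≤y ⟩
    z * y ≈⟨ *-comm z y ⟩
    y * z ∎

  *-mono-≤ : ∀ {x y u v} → 0# ≤ x → 0# ≤ v → x ≤ y → u ≤ v → x * u ≤ y * v
  *-mono-≤ 0≤x 0≤v x≤y u≤v = ≤-trans (*-monoˡ-≤ 0≤x u≤v) (*-monoʳ-≤ 0≤v x≤y)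

  -- By totality: if 1 ≤ 0 then -1 is nonnegative, and so is its square 1.
  0≤1 : 0# ≤ 1#
  0≤1 = [ id , (λ 1≤0 → let 0≤-1 = 0≤-x 1≤0 in begin
    0#          ≤⟨ *-nonNeg 0≤-1 0≤-1 ⟩
    - 1# * - 1# ≈⟨ -1*-1≈1 ⟩
    1#          ∎) ]′ (≤-total 0# 1#)
    where
    0≤-x : ∀ {x} → x ≤ 0# → 0# ≤ - x
    0≤-x {x} x≤0 = begin
      0#     ≤⟨ 0≤y-x x≤0 ⟩
      0# - x ≈⟨ +-identityˡ (- x) ⟩
      - x    ∎

    -1*-1≈1 : - 1# * - 1# ≈ 1#
    -1*-1≈1 = begin-equality
      - 1# * - 1# ≈⟨ -1*x≈-x (- 1#) ⟩
      - (- 1#)    ≈⟨ AbelianGroupProperties.⁻¹-involutive +-abelianGroup 1# ⟩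
      1#          ∎

  <⇒≱ : ∀ {x y} → x < y → ¬ y ≤ x
  <⇒≱ (x≤y , x≉y) y≤x = x≉y (antisym x≤y y≤x)

  ≰⇒> : ∀ {x y} → ¬ x ≤ y → y < x
  ≰⇒> {x} {y} x≰y = [ (λ x≤y → contradiction x≤y x≰y)
                    , (λ y≤x → y≤x , x≰y ∘ ≤-reflexive ∘ ≈-sym) ]′ (≤-total x y)

  *-inverse : ∀ {x} → 0# < x → x * x ⁻¹ ≈ 1#
  *-inverse (_ , 0≉x) = *-inverseʳ _ (0≉x ∘ ≈-sym)

  x/y*y≈x : ∀ x {y} → 0# < y → x / y * y ≈ x
  x/y*y≈x x {y} 0<y = begin-equality
    x * y ⁻¹ * y   ≈⟨ *-assoc x _ y ⟩
    x * (y ⁻¹ * y) ≈⟨ *-congˡ (≈-trans (*-comm _ y) (*-inverse 0<y)) ⟩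
    x * 1#         ≈⟨ *-identityʳ x ⟩
    x              ∎

  -- The sign of `z ⁻¹` is avoided: if y ≤ x, antisymmetry makes the products equal, and the inverse
  -- is applied to an equation only.
  *-cancelʳ-≤ : ∀ {z} → 0# < z → ∀ {x y} → x * z ≤ y * z → x ≤ y
  *-cancelʳ-≤ {z} 0<z@(0≤z , _) {x} {y} xz≤yz = [ id , (λ y≤x → ≤-reflexive (begin-equality
      x              ≈⟨ y*z/z≈y x ⟨
      (x * z) * z ⁻¹ ≈⟨ *-congʳ (antisym xz≤yz (*-monoʳ-≤ 0≤z y≤x)) ⟩
      (y * z) * z ⁻¹ ≈⟨ y*z/z≈y y ⟩
      y              ∎)) ]′ (≤-total x y)
    where
    y*z/z≈y : ∀ y → (y * z) * z ⁻¹ ≈ y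
    y*z/z≈y y = ≈-trans (*-assoc y z (z ⁻¹)) (≈-trans (*-congˡ (*-inverse 0<z)) (*-identityʳ y))

  <-≤-trans : ∀ {x y z} → x < y → y ≤ z → x < z
  <-≤-trans x<y y≤z = ≰⇒> λ z≤x → <⇒≱ x<y (≤-trans y≤z z≤x)

  *-pos : ∀ {x y} → 0# < x → 0# < y → 0# < x * y
  *-pos {x} {y} 0<x 0<y = ≰⇒> λ xy≤0 →
    <⇒≱ 0<x (*-cancelʳ-≤ 0<y (≤-trans xy≤0 (≤-reflexive (≈-sym (zeroˡ y)))))

  x≤x+y : ∀ x {y} → 0# ≤ y → x ≤ x + y
  x≤x+y x {y} 0≤y = ≤-trans (≤-reflexive (≈-sym (+-identityʳ x))) (+-monoʳ-≤ x 0≤y)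

  0<1 : 0# < 1#
  0<1 = 0≤1 , 0≉1

  fromℕ-nonNeg : ∀ n → 0# ≤ fromℕ n
  fromℕ-nonNeg zero    = ≤-refl
  fromℕ-nonNeg (suc n) = +-nonNeg 0≤1 (fromℕ-nonNeg n)

  fromℕ-mono-≤ : ∀ {m n} → m ℕ.≤ n → fromℕ m ≤ fromℕ n
  fromℕ-mono-≤ {n = n} z≤n = fromℕ-nonNeg n
  fromℕ-mono-≤ (s≤s m≤n)   = +-monoʳ-≤ 1# (fromℕ-mono-≤ m≤n)

  fromℕ-pos : ∀ {n} → 1 ℕ.≤ n → 0# < fromℕ n
  fromℕ-pos {suc n} _ = <-≤-trans 0<1 (x≤x+y 1# (fromℕ-nonNeg n))

  fromℕ-+ : ∀ m n → fromℕ (m ℕ.+ n) ≈ fromℕ m + fromℕ n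
  fromℕ-+ = ×-homo-+ 1#

  fromℕ-* : ∀ m n → fromℕ (m ℕ.* n) ≈ fromℕ m * fromℕ n
  fromℕ-* = ×1-homo-*

  -- Powers: tangents and Lipschitz bounds.

  ^-nonNeg : ∀ {x} → 0# ≤ x → ∀ k → 0# ≤ x ^ k
  ^-nonNeg 0≤x zero    = 0≤1
  ^-nonNeg 0≤x (suc k) = *-nonNeg 0≤x (^-nonNeg 0≤x k)

  ^≤1 : ∀ {x} → 0# ≤ x → x ≤ 1# → ∀ k → x ^ k ≤ 1#
  ^≤1 0≤x x≤1 zero    = ≤-refl
  ^≤1 {x} 0≤x x≤1 (suc k) = begin
    x * x ^ k ≤⟨ *-mono-≤ 0≤x 0≤1 x≤1 (^≤1 0≤x x≤1 k) ⟩
    1# * 1#   ≈⟨ *-identityˡ 1# ⟩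
    1#        ∎

  -- The sides differ by (y - x)². Ordering x and y first lets the larger be written as the smaller
  -- plus some d ≥ 0.
  2xy≤x²+y² : ∀ x y → x * y + x * y ≤ x * x + y * y
  2xy≤x²+y² x y = [ ordered x y , (λ y≤x → begin
      x * y + x * y ≈⟨ +-cong (*-comm x y) (*-comm x y) ⟩
      y * x + y * x ≤⟨ ordered y x y≤x ⟩
      y * y + x * x ≈⟨ +-comm _ _ ⟩
      x * x + y * y ∎) ]′ (≤-total x y)
    where
    ordered : ∀ x y → x ≤ y → x * y + x * y ≤ x * x + y * y
    ordered x y x≤y = begin
      x * y + x * y             ≈⟨ +-cong (*-congˡ y≈) (*-congˡ y≈) ⟩
      x * (x + d) + x * (x + d) ≤⟨ x≤x+y _ (*-nonNeg 0≤d 0≤d) ⟩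
      x * (x + d) + x * (x + d) + d * d
        ≈⟨ solve 2 (λ x d → x :* (x :+ d) :+ x :* (x :+ d) :+ d :* d
                         := x :* x :+ (x :+ d) :* (x :+ d)) ≈-refl x d ⟩
      x * x + (x + d) * (x + d) ≈⟨ +-congˡ (*-cong y≈ y≈) ⟨
      x * x + y * y             ∎
      where
      d = y - x
      0≤d = 0≤y-x x≤y

      y≈ : y ≈ x + d
      y≈ = ≈-sym (y+[x-y]≈x y x)

  -- The tangent inequality x^(k+1) ≥ y^(k+1) + (k+1) y^k (x - y), with both sides
  -- moved so that no subtraction occurs.
  tangent : ∀ {x y} → 0# ≤ x → 0# ≤ y → ∀ k →
    fromℕ (suc k) * y ^ k * x ≤ x ^ suc k + fromℕ k * y ^ suc k
  tangent {x} {y} 0≤x 0≤y zero = ≤-reflexive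
    (solve 2 (λ x y → (con 1 :+ con 0) :* con 1 :* x := x :* con 1 :+ con 0 :* (y :* con 1))
       ≈-refl x y)
  -- The added summand raises the coefficient of y^(k+1) x to 2 (k + 1), so 2xy ≤ x² + y² applies
  -- with the factor (k + 1) y^k. The x² part is x times the left side of the induction hypothesis,
  -- which gives the summand back.
  tangent {x} {y} 0≤x 0≤y (suc k) = +-cancelʳ-≤ (m * (y * z) * x) (begin
    (1# + (1# + m)) * (y * z) * x + m * (y * z) * x
      ≈⟨ solve 4 (λ m z x y → (con 1 :+ (con 1 :+ m)) :* (y :* z) :* x :+ m :* (y :* z) :* x
                            := (con 1 :+ m) :* z :* (x :* y :+ x :* y)) ≈-refl m z x y ⟩
    (1# + m) * z * (x * y + x * y)
      ≤⟨ *-monoˡ-≤ (*-nonNeg (fromℕ-nonNeg (suc k)) (^-nonNeg 0≤y k)) (2xy≤x²+y² x y) ⟩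
    (1# + m) * z * (x * x + y * y)
      ≈⟨ solve 4 (λ m z x y → (con 1 :+ m) :* z :* (x :* x :+ y :* y)
                 := x :* ((con 1 :+ m) :* z :* x) :+ (con 1 :+ m) :* (y :* (y :* z))) ≈-refl m z x y ⟩
    x * ((1# + m) * z * x) + (1# + m) * (y * (y * z))
      ≤⟨ +-monoˡ-≤ _ (*-monoˡ-≤ 0≤x (tangent 0≤x 0≤y k)) ⟩
    x * (w + m * (y * z)) + (1# + m) * (y * (y * z))
      ≈⟨ solve 5 (λ m z x y w → x :* (w :+ m :* (y :* z)) :+ (con 1 :+ m) :* (y :* (y :* z))
                 := x :* w :+ (con 1 :+ m) :* (y :* (y :* z)) :+ m :* (y :* z) :* x) ≈-refl m z x y w ⟩
    x * w + (1# + m) * (y * (y * z)) + m * (y * z) * x ∎)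
    where
    m = fromℕ k
    z = y ^ k
    w = x ^ suc k

  -- On [0, 1] the derivative of the k-th power is at most k. This is the continuity that `crossing`
  -- needs, in quantitative form.
  ^-lipschitz : ∀ {x y} → 0# ≤ x → x ≤ y → y ≤ 1# → ∀ k → y ^ k ≤ x ^ k + fromℕ k * (y - x)
  ^-lipschitz {x} {y} 0≤x x≤y y≤1 zero = x≤x+y 1# (≤-reflexive (≈-sym (zeroˡ _)))
  ^-lipschitz {x} {y} 0≤x x≤y y≤1 (suc k) = begin
    y * y ^ k                   ≈⟨ *-congʳ (y+[x-y]≈x y x) ⟨
    (x + d) * y ^ k             ≈⟨ distribʳ (y ^ k) x d ⟩
    x * y ^ k + d * y ^ k       ≤⟨ +-mono-≤ (*-monoˡ-≤ 0≤x (^-lipschitz 0≤x x≤y y≤1 k))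
                                            (*-monoˡ-≤ 0≤d (^≤1 (≤-trans 0≤x x≤y) y≤1 k)) ⟩
    x * (x ^ k + m * d) + d * 1#
      ≈⟨ solve 4 (λ x w m d → x :* (w :+ m :* d) :+ d :* con 1 := x :* w :+ d :+ x :* (m :* d))
           ≈-refl x (x ^ k) m d ⟩
    x * x ^ k + d + x * (m * d)
      ≤⟨ +-monoʳ-≤ _ (*-monoʳ-≤ (*-nonNeg (fromℕ-nonNeg k) 0≤d) (≤-trans x≤y y≤1)) ⟩
    x * x ^ k + d + 1# * (m * d)
      ≈⟨ solve 3 (λ w m d → w :+ d :+ con 1 :* (m :* d) := w :+ (con 1 :+ m) :* d)
           ≈-refl (x * x ^ k) m d ⟩
    x * x ^ k + (1# + m) * d    ∎
    where
    d = y - x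
    m = fromℕ k
    0≤d = 0≤y-x x≤y

  -- Existence of the minimum.

  -- The common value is attained at the supremum of the points with u ≤ v.
  crossing : (u v : Carrier → Carrier) (L : Carrier) → 0# < L →
    u 0# ≤ v 0# → v 1# ≤ u 1# →
    (∀ {x y} → 0# ≤ x → x ≤ y → y ≤ 1# → u y + v x ≤ u x + v y + L * (y - x)) →
    Σ[ s ∈ Carrier ] UnitInterval s × u s ≈ v s
  crossing u v L 0<L u0≤v0 v1≤u1 lipschitz =
    s , (0≤s , s≤1) , antisym us≤vs vs≤us
    where
    P : Carrier → Set ℓ₂
    P x = UnitInterval x × u x ≤ v x

    0∈P : P 0#
    0∈P = (≤-refl , 0≤1) , u0≤v0

    sup = supremum P (0# , 0∈P) (1# , λ _ → proj₂ ∘ proj₁)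
    s = proj₁ sup
    upper = proj₁ (proj₂ sup)
    least = proj₂ (proj₂ sup)

    0≤s : 0# ≤ s
    0≤s = upper 0# 0∈P

    s≤1 : s ≤ 1#
    s≤1 = least 1# λ _ → proj₂ ∘ proj₁

    -- As `u - v` rises by at most `L` per unit length, it needs at least this distance to rise by
    -- `y - x`.
    gap : Carrier → Carrier → Carrier
    gap x y = (y - x) / L

    gap-pos : ∀ {x y} → x < y → 0# < gap x y
    gap-pos {x} {y} x<y@(x≤y , _) = ≰⇒> λ δ≤0 → <⇒≱ x<y (begin
      y                  ≈⟨ y+[x-y]≈x y x ⟨
      x + (y - x)        ≈⟨ +-congˡ (x/y*y≈x (y - x) 0<L) ⟨
      x + gap x y * L    ≤⟨ +-monoʳ-≤ x (*-monoʳ-≤ (proj₁ 0<L) δ≤0) ⟩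
      x + 0# * L         ≈⟨ +-congˡ (zeroˡ L) ⟩
      x + 0#             ≈⟨ +-identityʳ x ⟩
      x                  ∎)

    gap-≤ : ∀ {x y z} → y ≤ x + L * z → gap x y ≤ z
    gap-≤ {x} {y} {z} y≤ = *-cancelʳ-≤ 0<L (+-cancelʳ-≤ x (begin
      gap x y * L + x ≈⟨ +-congʳ (x/y*y≈x (y - x) 0<L) ⟩
      y - x + x       ≈⟨ x-y+y≈x y x ⟩
      y               ≤⟨ y≤ ⟩
      x + L * z       ≈⟨ solve 3 (λ x L z → x :+ L :* z := z :* L :+ x) ≈-refl x L z ⟩
      z * L + x       ∎))

    -- If u s exceeds v s, every point of `P` lies at least δ below s, so s - δ would be a smaller
    -- upper bound.
    us≤vs : u s ≤ v s
    us≤vs with u s ≤? v s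
    ... | yes us≤vs = us≤vs
    ... | no us≰vs = contradiction s≤s-δ (<⇒≱ s-δ<s)
      where
      δ = gap (v s) (u s)
      0<δ = gap-pos (≰⇒> us≰vs)

      s-δ<s : s - δ < s
      s-δ<s = ≰⇒> λ s≤s-δ → <⇒≱ 0<δ (+-cancelʳ-≤ (s - δ) (begin
        δ + (s - δ)  ≈⟨ y+[x-y]≈x s δ ⟩
        s            ≤⟨ s≤s-δ ⟩
        s - δ        ≈⟨ +-identityˡ _ ⟨
        0# + (s - δ) ∎))

      bound : (s - δ) IsUpperBoundOf P
      bound x x∈P@((0≤x , _) , ux≤vx) = +-cancelʳ-≤ δ (begin
        x + δ       ≤⟨ +-monoʳ-≤ x (gap-≤ (+-cancelʳ-≤ (v x) (begin
            u s + v x               ≤⟨ lipschitz 0≤x (upper x x∈P) s≤1 ⟩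
            u x + v s + L * (s - x) ≤⟨ +-monoˡ-≤ _ (+-monoˡ-≤ _ ux≤vx) ⟩
            v x + v s + L * (s - x) ≈⟨ solve 3 (λ a b c → a :+ b :+ c := b :+ c :+ a) ≈-refl _ _ _ ⟩
            v s + L * (s - x) + v x ∎))) ⟩
        x + (s - x) ≈⟨ y+[x-y]≈x s x ⟩
        s           ≈⟨ x-y+y≈x s δ ⟨
        s - δ + δ   ∎)

      s≤s-δ = least (s - δ) bound

    -- If v s exceeds u s, then u ≤ v still holds at s + δ, and s + δ ≤ 1 because v ≤ u at 1; so s
    -- would not bound `P`.
    vs≤us : v s ≤ u s
    vs≤us with v s ≤? u s
    ... | yes vs≤us = vs≤us
    ... | no vs≰us = contradiction (upper (s + δ) s+δ∈P) (<⇒≱ s<s+δ)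
      where
      δ = gap (u s) (v s)
      0<δ = gap-pos (≰⇒> vs≰us)

      s<s+δ : s < s + δ
      s<s+δ = ≰⇒> λ s+δ≤s → <⇒≱ 0<δ (+-cancelʳ-≤ s (begin
        δ + s  ≈⟨ +-comm δ s ⟩
        s + δ  ≤⟨ s+δ≤s ⟩
        s      ≈⟨ +-identityˡ s ⟨
        0# + s ∎))

      s+δ≤1 : s + δ ≤ 1#
      s+δ≤1 = begin
        s + δ        ≤⟨ +-monoʳ-≤ s (gap-≤ (+-cancelʳ-≤ (u 1#) (begin
          v s + u 1#                ≈⟨ +-comm _ _ ⟩
          u 1# + v s                ≤⟨ lipschitz 0≤s s≤1 ≤-refl ⟩
          u s + v 1# + L * (1# - s) ≤⟨ +-monoˡ-≤ _ (+-monoʳ-≤ _ v1≤u1) ⟩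
          u s + u 1# + L * (1# - s) ≈⟨ solve 3 (λ a b c → a :+ b :+ c := a :+ c :+ b) ≈-refl _ _ _ ⟩
          u s + L * (1# - s) + u 1# ∎))) ⟩
        s + (1# - s) ≈⟨ y+[x-y]≈x 1# s ⟩
        1#           ∎

      s+δ∈P : P (s + δ)
      s+δ∈P = (≤-trans 0≤s (proj₁ s<s+δ) , s+δ≤1) , +-cancelʳ-≤ (v s) (begin
        u (s + δ) + v s
          ≤⟨ lipschitz 0≤s (proj₁ s<s+δ) s+δ≤1 ⟩
        u s + v (s + δ) + L * (s + δ - s)
          ≈⟨ +-congˡ (*-congˡ (≈-trans (+-congʳ (+-comm s δ)) (x+y-y≈x δ s))) ⟩
        u s + v (s + δ) + L * δ
          ≈⟨ +-congˡ (≈-trans (*-comm L δ) (x/y*y≈x _ 0<L)) ⟩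
        u s + v (s + δ) + (v s - u s)
          ≈⟨ solve 3 (λ a b c → a :+ b :+ c := b :+ (a :+ c)) ≈-refl (u s) (v (s + δ)) _ ⟩
        v (s + δ) + (u s + (v s - u s))
          ≈⟨ +-congˡ (y+[x-y]≈x (v s) (u s)) ⟩
        v (s + δ) + v s ∎)

  1-x+x≈1 : ∀ x → 1# - x + x ≈ 1#
  1-x+x≈1 = x-y+y≈x 1#

  1-x≤1 : ∀ {x} → 0# ≤ x → 1# - x ≤ 1#
  1-x≤1 {x} 0≤x = begin
    1# - x     ≤⟨ x≤x+y _ 0≤x ⟩
    1# - x + x ≈⟨ 1-x+x≈1 x ⟩
    1#         ∎

  1-antimono-≤ : ∀ {x y} → x ≤ y → 1# - y ≤ 1# - x
  1-antimono-≤ {x} {y} x≤y = +-cancelʳ-≤ x (begin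
    1# - y + x ≤⟨ +-monoʳ-≤ _ x≤y ⟩
    1# - y + y ≈⟨ 1-x+x≈1 y ⟩
    1#         ≈⟨ 1-x+x≈1 x ⟨
    1# - x + x ∎)

  [1-x]-[1-y]≈y-x : ∀ x y → 1# - x - (1# - y) ≈ y - x
  [1-x]-[1-y]≈y-x x y = begin-equality
    1# - x - (1# - y)
      ≈⟨ +-congʳ (+-identityʳ _) ⟨
    1# - x + 0# - (1# - y)
      ≈⟨ +-congʳ (+-congˡ (-‿inverseˡ y)) ⟨
    1# - x + (- y + y) - (1# - y)
      ≈⟨ +-congʳ (solve 4 (λ i a b y → i :+ a :+ (b :+ y) := y :+ a :+ (i :+ b))
                   ≈-refl 1# (- x) (- y) y) ⟩
    y - x + (1# - y) - (1# - y)
      ≈⟨ x+y-y≈x (y - x) (1# - y) ⟩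
    y - x ∎

  -- Where the derivatives of the two convex terms cancel, the tangents of the
  -- terms add up to a constant lower bound.
  minimum : ∀ {a b i j} → 0# ≤ a → 0# ≤ b → 2 ℕ.≤ i → 2 ℕ.≤ j →
    ∃ (IsMinimum UnitInterval λ p → a * p ^ i + b * (1# - p) ^ j)
  minimum {a} {b} {suc (suc k)} {suc (suc l)} 0≤a 0≤b (s≤s (s≤s _)) (s≤s (s≤s _)) = f s , record
    { attained   = s , s∈I , ≈-refl
    ; lowerBound = lower
    }
    where
    f : Carrier → Carrier
    f p = a * p ^ suc (suc k) + b * (1# - p) ^ suc (suc l)

    m n a′ b′ L : Carrier
    m = fromℕ (suc k)
    n = fromℕ (suc l)
    a′ = a * fromℕ (suc (suc k))
    b′ = b * fromℕ (suc (suc l))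
    -- `m` and `n` are the Lipschitz constants of the powers in `u` and `v`. The summand `1#` keeps
    -- `L` positive even if a and b vanish, as happens when neither star fits into the vertex set.
    L = 1# + (a′ * m + b′ * n)

    0≤a′ : 0# ≤ a′
    0≤a′ = *-nonNeg 0≤a (fromℕ-nonNeg (suc (suc k)))

    0≤b′ : 0# ≤ b′
    0≤b′ = *-nonNeg 0≤b (fromℕ-nonNeg (suc (suc l)))

    -- The derivative of `f` is `u - v`.
    u v : Carrier → Carrier
    u p = a′ * p ^ suc k
    v p = b′ * (1# - p) ^ suc l

    lipschitz : ∀ {x y} → 0# ≤ x → x ≤ y → y ≤ 1# → u y + v x ≤ u x + v y + L * (y - x)
    lipschitz {x} {y} 0≤x x≤y y≤1 = begin
      a′ * y ^ suc k + b′ * (1# - x) ^ suc l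
        ≤⟨ +-mono-≤ (*-monoˡ-≤ 0≤a′ (^-lipschitz 0≤x x≤y y≤1 (suc k)))
             (*-monoˡ-≤ 0≤b′ (^-lipschitz (0≤y-x y≤1) (1-antimono-≤ x≤y) (1-x≤1 0≤x) (suc l))) ⟩
      a′ * (x ^ suc k + m * (y - x)) + b′ * ((1# - y) ^ suc l + n * (1# - x - (1# - y)))
        ≈⟨ +-congˡ (*-congˡ (+-congˡ (*-congˡ ([1-x]-[1-y]≈y-x x y)))) ⟩
      a′ * (x ^ suc k + m * (y - x)) + b′ * ((1# - y) ^ suc l + n * (y - x))
        ≤⟨ x≤x+y _ (0≤y-x x≤y) ⟩
      a′ * (x ^ suc k + m * (y - x)) + b′ * ((1# - y) ^ suc l + n * (y - x)) + (y - x)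
        ≈⟨ solve 7 (λ a b m n w z d → a :* (w :+ m :* d) :+ b :* (z :+ n :* d) :+ d
               := a :* w :+ b :* z :+ (con 1 :+ (a :* m :+ b :* n)) :* d)
             ≈-refl a′ b′ m n (x ^ suc k) ((1# - y) ^ suc l) (y - x) ⟩
      u x + v y + L * (y - x) ∎

    0<L : 0# < L
    0<L = <-≤-trans 0<1 (x≤x+y 1# (+-nonNeg (*-nonNeg 0≤a′ (fromℕ-nonNeg (suc k)))
                                     (*-nonNeg 0≤b′ (fromℕ-nonNeg (suc l)))))

    -- The exponents of `f` are at least 2, so `u` vanishes at 0 and `v` at 1.
    u0≤v0 : u 0# ≤ v 0#
    u0≤v0 = begin
      a′ * 0# ^ suc k ≈⟨ *-congˡ (zeroˡ _) ⟩
      a′ * 0#         ≈⟨ zeroʳ a′ ⟩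
      0#              ≤⟨ *-nonNeg 0≤b′ (^-nonNeg (0≤y-x 0≤1) (suc l)) ⟩
      v 0#            ∎

    v1≤u1 : v 1# ≤ u 1#
    v1≤u1 = begin
      b′ * (1# - 1#) ^ suc l ≈⟨ *-congˡ (≈-trans (*-congʳ (-‿inverseʳ 1#)) (zeroˡ _)) ⟩
      b′ * 0#                ≈⟨ zeroʳ b′ ⟩
      0#                     ≤⟨ *-nonNeg 0≤a′ (^-nonNeg 0≤1 (suc k)) ⟩
      u 1#                   ∎

    cross = crossing u v L 0<L u0≤v0 v1≤u1 lipschitz
    s = proj₁ cross
    s∈I = proj₁ (proj₂ cross)
    us≈vs = proj₂ (proj₂ cross)

    scaledTangent : ∀ {c x y} j → 0# ≤ c → 0# ≤ x → 0# ≤ y →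
      c * fromℕ (suc j) * y ^ j * x + c * y ^ suc j ≤ c * x ^ suc j + c * fromℕ (suc j) * y ^ j * y
    scaledTangent {c} {x} {y} j 0≤c 0≤x 0≤y = begin
      c * fromℕ (suc j) * z * x + c * (y * z)
        ≈⟨ solve 5 (λ c m z x y → c :* m :* z :* x :+ c :* (y :* z) := c :* (m :* z :* x :+ y :* z))
             ≈-refl c (fromℕ (suc j)) z x y ⟩
      c * (fromℕ (suc j) * z * x + y * z)
        ≤⟨ *-monoˡ-≤ 0≤c (+-monoˡ-≤ (y * z) (tangent 0≤x 0≤y j)) ⟩
      c * (w + fromℕ j * (y * z) + y * z)
        ≈⟨ solve 5 (λ c m z w y → c :* (w :+ m :* (y :* z) :+ y :* z)
                               := c :* w :+ c :* (con 1 :+ m) :* z :* y)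
             ≈-refl c (fromℕ j) z w y ⟩
      c * w + c * fromℕ (suc j) * z * y ∎
      where
      z = y ^ j
      w = x ^ suc j

    lower : ∀ p → UnitInterval p → f s ≤ f p
    -- Since u s ≈ v s, the linear parts u s * q + v s * (1 - q) of the two tangents add up to u s,
    -- for q = p as for q = s. Adding u s on both sides avoids subtracting them.
    lower p (0≤p , p≤1) = +-cancelʳ-≤ (u s) (begin
      f s + u s                              ≈⟨ +-congˡ (split p) ⟩
      f s + (u s * p + v s * (1# - p))
        ≈⟨ solve 4 (λ x y z w → x :+ y :+ (z :+ w) := z :+ x :+ (w :+ y)) ≈-refl _ _ _ _ ⟩
      u s * p + a * s ^ suc (suc k) + (v s * (1# - p) + b * (1# - s) ^ suc (suc l))
        ≤⟨ +-mono-≤ (scaledTangent (suc k) 0≤a 0≤p (proj₁ s∈I))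
                    (scaledTangent (suc l) 0≤b (0≤y-x p≤1) (0≤y-x (proj₂ s∈I))) ⟩
      a * p ^ suc (suc k) + u s * s + (b * (1# - p) ^ suc (suc l) + v s * (1# - s))
        ≈⟨ solve 4 (λ x y z w → x :+ y :+ (z :+ w) := x :+ z :+ (y :+ w)) ≈-refl _ _ _ _ ⟩
      f p + (u s * s + v s * (1# - s))       ≈⟨ +-congˡ (split s) ⟨
      f p + u s                              ∎)
      where
      split : ∀ q → u s ≈ u s * q + v s * (1# - q)
      split q = begin-equality
        u s                        ≈⟨ *-identityʳ (u s) ⟨
        u s * 1#                   ≈⟨ *-congˡ (y+[x-y]≈x 1# q) ⟨
        u s * (q + (1# - q))       ≈⟨ distribˡ (u s) q (1# - q) ⟩
        u s * q + u s * (1# - q)   ≈⟨ +-congˡ (*-congʳ us≈vs) ⟩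
        u s * q + v s * (1# - q)   ∎

  -- Random colourings.

  module Expectation (n : ℕ) (p : Color → Carrier)
    (0≤p : ∀ i → 0# ≤ p i) (∑p≈1 : p red + p blue ≈ 1#) where

    -- The listed edges are coloured independently, the others red.  A repeated edge
    -- keeps the colour drawn at its first occurrence.
    𝔼 : List (Edge (𝒦 n)) → (Coloring n → Carrier) → Carrier
    𝔼 []       F = F (λ _ → red)
    𝔼 (e ∷ es) F = p red * 𝔼 es (F ∘ paint e red) + p blue * 𝔼 es (F ∘ paint e blue)

    mix : ∀ x → p red * x + p blue * x ≈ x
    mix x = ≈-trans (≈-sym (distribʳ x (p red) (p blue))) (≈-trans (*-congʳ ∑p≈1) (*-identityˡ x))

    𝔼-mono : ∀ es {F G} → (∀ χ → F χ ≤ G χ) → 𝔼 es F ≤ 𝔼 es G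
    𝔼-mono []       F≤G = F≤G _
    𝔼-mono (e ∷ es) F≤G = +-mono-≤ (*-monoˡ-≤ (0≤p red) (𝔼-mono es (F≤G ∘ paint e red)))
                                   (*-monoˡ-≤ (0≤p blue) (𝔼-mono es (F≤G ∘ paint e blue)))

    𝔼-const : ∀ es x → 𝔼 es (λ _ → x) ≈ x
    𝔼-const []       x = ≈-refl
    𝔼-const (e ∷ es) x = ≈-trans (+-cong (*-congˡ (𝔼-const es x)) (*-congˡ (𝔼-const es x))) (mix x)

    𝔼-upper : ∀ es {F x} → (∀ χ → F χ ≤ x) → 𝔼 es F ≤ x
    𝔼-upper es {x = x} F≤x = ≤-trans (𝔼-mono es F≤x) (≤-reflexive (𝔼-const es x))

    𝔼-lower : ∀ es {F x} → (∀ χ → x ≤ F χ) → x ≤ 𝔼 es F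
    𝔼-lower es {x = x} x≤F = ≤-trans (≤-reflexive (≈-sym (𝔼-const es x))) (𝔼-mono es x≤F)

    𝔼-+ : ∀ es F G → 𝔼 es (λ χ → F χ + G χ) ≈ 𝔼 es F + 𝔼 es G
    𝔼-+ []       F G = ≈-refl
    𝔼-+ (e ∷ es) F G = ≈-trans
      (+-cong (*-congˡ (𝔼-+ es (F ∘ paint e red) (G ∘ paint e red)))
              (*-congˡ (𝔼-+ es (F ∘ paint e blue) (G ∘ paint e blue))))
      (solve 6 (λ p q a b c d → p :* (a :+ b) :+ q :* (c :+ d)
                             := p :* a :+ q :* c :+ (p :* b :+ q :* d))
         ≈-refl (p red) (p blue) _ _ _ _)

    𝔼-* : ∀ es x F → 𝔼 es (λ χ → x * F χ) ≈ x * 𝔼 es F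
    𝔼-* []       x F = ≈-refl
    𝔼-* (e ∷ es) x F = ≈-trans
      (+-cong (*-congˡ (𝔼-* es x (F ∘ paint e red))) (*-congˡ (𝔼-* es x (F ∘ paint e blue))))
      (solve 5 (λ p q x a b → p :* (x :* a) :+ q :* (x :* b) := x :* (p :* a :+ q :* b))
         ≈-refl (p red) (p blue) x _ _)

    -- For F the indicator of an event forcing colour i on L.
    𝔼-event : ∀ es L i (F : Coloring n → Carrier) → Unique L → (∀ {e} → e ∈ L → e ∈ es) →
      (∀ χ → F χ ≤ 1#) → (∀ χ → ¬ (∀ {e} → e ∈ L → χ e ≡ i) → F χ ≤ 0#) → 𝔼 es F ≤ p i ^ length L
    𝔼-event [] [] i F _ _ F≤1 _ = F≤1 _
    𝔼-event [] (e ∷ L) i F _ L⊆ _ _ with () ← L⊆ (here refl)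
    𝔼-event (e ∷ es) L i F unique L⊆ F≤1 F≤0 with Any.any? (e ≟ᴱ_) L
    ... | no e∉L = begin
      p red * 𝔼 es (F ∘ paint e red) + p blue * 𝔼 es (F ∘ paint e blue)
        ≤⟨ +-mono-≤ (*-monoˡ-≤ (0≤p red) (ih red)) (*-monoˡ-≤ (0≤p blue) (ih blue)) ⟩
      p red * p i ^ length L + p blue * p i ^ length L
        ≈⟨ mix _ ⟩
      p i ^ length L ∎
      where
      ≢e : ∀ {e′} → e′ ∈ L → e′ ≢ e
      ≢e e′∈ refl = e∉L e′∈

      L⊆′ : ∀ {e′} → e′ ∈ L → e′ ∈ es
      L⊆′ e′∈ with L⊆ e′∈
      ... | here e′≡e = contradiction e′≡e (≢e e′∈)
      ... | there e′∈es = e′∈es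

      ih : ∀ j → 𝔼 es (F ∘ paint e j) ≤ p i ^ length L
      ih j = 𝔼-event es L i (F ∘ paint e j) unique L⊆′ (λ χ → F≤1 (paint e j χ))
        (λ χ ¬all → F≤0 (paint e j χ) λ all → ¬all λ e′∈ →
          trans (sym (paint-≢ e j χ (≢e e′∈))) (all e′∈))
    -- Only the branch drawing colour i for `e` contributes: it gives the factor p i and leaves the
    -- event on the other edges of `L`.
    ... | yes e∈L = begin
      p red * 𝔼 es (F ∘ paint e red) + p blue * 𝔼 es (F ∘ paint e blue)
        ≤⟨ bound i same other ⟩
      p i * p i ^ length R.rest
        ≡⟨ cong (p i ^_) R.length≡ ⟨
      p i ^ length L ∎
      where
      module R = Removal (remove unique e∈L)

      rest⊆es : ∀ {e′} → e′ ∈ R.rest → e′ ∈ es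
      rest⊆es e′∈ with L⊆ (R.rest⊆ e′∈)
      ... | here refl = contradiction e′∈ R.x∉rest
      ... | there e′∈es = e′∈es

      same : 𝔼 es (F ∘ paint e i) ≤ p i ^ length R.rest
      same = 𝔼-event es R.rest i (F ∘ paint e i) R.unique rest⊆es (λ χ → F≤1 (paint e i χ))
        (λ χ ¬all → F≤0 (paint e i χ) λ all → ¬all λ e′∈ →
          trans (sym (paint-≢ e i χ λ { refl → R.x∉rest e′∈ })) (all (R.rest⊆ e′∈)))

      -- `paint e j` is applied after all later draws, so none of them can repair a wrong colour of
      -- `e`.
      other : ∀ j → j ≢ i → 𝔼 es (F ∘ paint e j) ≤ 0#
      other j j≢i = 𝔼-upper es λ χ → F≤0 (paint e j χ) λ all →
        j≢i (trans (sym (paint-≡ e j χ)) (all e∈L))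

      bound : ∀ i {x} → 𝔼 es (F ∘ paint e i) ≤ x → (∀ j → j ≢ i → 𝔼 es (F ∘ paint e j) ≤ 0#) →
        p red * 𝔼 es (F ∘ paint e red) + p blue * 𝔼 es (F ∘ paint e blue) ≤ p i * x
      bound red {x} same other = begin
        p red * 𝔼 es (F ∘ paint e red) + p blue * 𝔼 es (F ∘ paint e blue)
          ≤⟨ +-mono-≤ (*-monoˡ-≤ (0≤p red) same) (*-monoˡ-≤ (0≤p blue) (other blue λ ())) ⟩
        p red * x + p blue * 0# ≈⟨ +-congˡ (zeroʳ (p blue)) ⟩
        p red * x + 0#          ≈⟨ +-identityʳ _ ⟩
        p red * x               ∎
      bound blue {x} same other = begin
        p red * 𝔼 es (F ∘ paint e red) + p blue * 𝔼 es (F ∘ paint e blue)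
          ≤⟨ +-mono-≤ (*-monoˡ-≤ (0≤p red) (other red λ ())) (*-monoˡ-≤ (0≤p blue) same) ⟩
        p red * 0# + p blue * x ≈⟨ +-congʳ (zeroʳ (p red)) ⟩
        0# + p blue * x         ≈⟨ +-identityˡ _ ⟩
        p blue * x              ∎

    fromℕ-indicator≤1 : ∀ b → fromℕ (indicator b) ≤ 1#
    fromℕ-indicator≤1 true  = ≤-reflexive (+-identityʳ 1#)
    fromℕ-indicator≤1 false = 0≤1

    -- Linearity of expectation. The factor q is kept apart from `b`, whose total is then a pure
    -- count and becomes a binomial coefficient.
    𝔼-subsetSum : ∀ m (F : Coloring n → Subset m → ℕ) (b : Subset m → ℕ) q →
      (∀ S → 𝔼 (edges n) (λ χ → fromℕ (F χ S)) ≤ fromℕ (b S) * q) →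
      𝔼 (edges n) (λ χ → fromℕ (subsetSum m (F χ))) ≤ fromℕ (subsetSum m b) * q
    𝔼-subsetSum zero    F b q bound = bound []
    𝔼-subsetSum (suc m) F b q bound = begin
      𝔼 (edges n) (λ χ → fromℕ (subsetSum m (F χ ∘ (outside ∷_)) ℕ.+ subsetSum m (F χ ∘ (inside ∷_))))
        ≤⟨ 𝔼-mono (edges n) (λ χ → ≤-reflexive (fromℕ-+ (subsetSum m (F χ ∘ (outside ∷_))) _)) ⟩
      𝔼 (edges n) (λ χ → fromℕ (subsetSum m (F χ ∘ (outside ∷_))) +
                         fromℕ (subsetSum m (F χ ∘ (inside ∷_))))
        ≈⟨ 𝔼-+ (edges n) _ _ ⟩
      𝔼 (edges n) (λ χ → fromℕ (subsetSum m (F χ ∘ (outside ∷_)))) +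
      𝔼 (edges n) (λ χ → fromℕ (subsetSum m (F χ ∘ (inside ∷_))))
        ≤⟨ +-mono-≤ (𝔼-subsetSum m (λ χ → F χ ∘ (outside ∷_)) _ q (bound ∘ (outside ∷_)))
                    (𝔼-subsetSum m (λ χ → F χ ∘ (inside ∷_)) _ q (bound ∘ (inside ∷_))) ⟩
      fromℕ (subsetSum m (b ∘ (outside ∷_))) * q + fromℕ (subsetSum m (b ∘ (inside ∷_))) * q
        ≈⟨ distribʳ q _ _ ⟨
      (fromℕ (subsetSum m (b ∘ (outside ∷_))) + fromℕ (subsetSum m (b ∘ (inside ∷_)))) * q
        ≈⟨ *-congʳ (fromℕ-+ (subsetSum m (b ∘ (outside ∷_))) _) ⟨
      fromℕ (subsetSum (suc m) b) * q ∎

    module _ {H : OrderedGraph} {L : List (Edge H)} (unique : Unique L) (i : Color) where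

      copyIndicator : Coloring n → Subset n → ℕ
      copyIndicator χ S = indicator (does (hasCopyOn? χ i H S))

      -- Whether `S` carries a copy of `H` at all does not depend on the colouring, so this is
      -- decided outside the expectation. If it does, that copy is the only candidate, and the event
      -- forces colour i on the images of `L`.
      𝔼-copyOn : ∀ S → 𝔼 (edges n) (λ χ → fromℕ (copyIndicator χ S)) ≤
        fromℕ (indicator (does (∣ S ∣ ℕ.≟ size H))) * p i ^ length L
      𝔼-copyOn S with anyVec? (λ f → isCopy? H (𝒦 n) f ×-dec ≡-dec Bool._≟_ (vertexSet f) S)
      ... | no ¬copy = ≤-trans (𝔼-upper (edges n) never) (*-nonNeg
           (fromℕ-nonNeg (indicator (does (∣ S ∣ ℕ.≟ size H))))
           (^-nonNeg (0≤p i) (length L)))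
        where
        never : ∀ χ → fromℕ (copyIndicator χ S) ≤ 0#
        never χ with hasCopyOn? χ i H S
        ... | yes (f , (c , _) , S≡) = contradiction (f , c , S≡) ¬copy
        ... | no _ = ≤-refl
      ... | yes (f , c , refl) = begin
        𝔼 (edges n) (λ χ → fromℕ (copyIndicator χ (vertexSet f)))
          ≤⟨ 𝔼-event (edges n) (List.map (mapEdge c) L) i _ (Unique.map⁺ (mapEdge-injective c) unique)
               (λ {e} _ → ∈-edges e)
               (λ χ → fromℕ-indicator≤1 (does (hasCopyOn? χ i H (vertexSet f)))) only ⟩
        p i ^ length (List.map (mapEdge c) L)
          ≡⟨ cong (p i ^_) (List.length-map (mapEdge c) L) ⟩
        p i ^ length L
          ≈⟨ *-identityˡ _ ⟨
        1# * p i ^ length L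
          ≈⟨ *-congʳ (+-identityʳ 1#) ⟨
        fromℕ 1 * p i ^ length L
          ≡⟨ cong (λ b → fromℕ (indicator b) * p i ^ length L)
               (dec-true (∣ vertexSet f ∣ ℕ.≟ size H) (∣vertexSet∣ f (IsCopy.mono c))) ⟨
        fromℕ (indicator (does (∣ vertexSet f ∣ ℕ.≟ size H))) * p i ^ length L ∎
        where
        only : ∀ χ → ¬ (∀ {e} → e ∈ List.map (mapEdge c) L → χ e ≡ i) →
          fromℕ (copyIndicator χ (vertexSet f)) ≤ 0#
        only χ ¬all with hasCopyOn? χ i H (vertexSet f)
        ... | no _ = ≤-refl
        ... | yes (g , (d , mono) , g≡f)
          with refl ← vertexSet-injective g f (IsCopy.mono d) (IsCopy.mono c) g≡f =
          ⊥-elim (¬all λ e∈ →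
            let e′ , _ , e≡ = ∈-map⁻ (mapEdge c) e∈ in trans (cong χ e≡) (mono e′))

      𝔼-copies : 𝔼 (edges n) (λ χ → fromℕ (copies χ i H)) ≤ binom n (size H) * p i ^ length L
      𝔼-copies = begin
        𝔼 (edges n) (λ χ → fromℕ (copies χ i H))
          ≤⟨ 𝔼-mono (edges n) (λ χ → ≤-reflexive (≈-reflexive
               (cong fromℕ (length-filter-subsets n (hasCopyOn? χ i H))))) ⟩
        𝔼 (edges n) (λ χ → fromℕ (subsetSum n (copyIndicator χ)))
          ≤⟨ 𝔼-subsetSum n copyIndicator _ (p i ^ length L) 𝔼-copyOn ⟩
        fromℕ (subsetSum n (λ S → indicator (does (∣ S ∣ ℕ.≟ size H)))) * p i ^ length L
          ≡⟨ cong (λ k → fromℕ k * p i ^ length L) (subsetSum-∣∣≡ n (size H)) ⟩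
        binom n (size H) * p i ^ length L ∎

  -- Lower bounds by averaging over deletions.

  module Bounds (G : Color → OrderedGraph) (w : Color → Carrier) (0<w : ∀ i → 0# < w i) where

    M : ℕ → Carrier
    M n = multiplicity w n G

    h : Color → ℕ
    h i = size (G i)

    M≤weight : ∀ {n} (χ : Coloring n) → M n ≤ weight w G χ
    M≤weight {n} χ = IsMinimum.lowerBound (multiplicity-isMinimum w n G) χ _

    ≤M : ∀ {n x} → (∀ (χ : Coloring n) → x ≤ weight w G χ) → x ≤ M n
    ≤M {n} x≤ = let χ , _ , M≈ = IsMinimum.attained (multiplicity-isMinimum w n G)
                in ≤-trans (x≤ χ) (≤-reflexive (≈-sym M≈))

    0≤w : ∀ i → 0# ≤ w i
    0≤w i = proj₁ (0<w i)

    fromℕ*≤sum : ∀ m (f g : Fin m → ℕ) {x y z} →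
      (∀ v → x ≤ y * fromℕ (f v) + z * fromℕ (g v)) →
      fromℕ m * x ≤ y * fromℕ (sum f) + z * fromℕ (sum g)
    fromℕ*≤sum zero f g {x} {y} {z} bound = ≤-reflexive
      (solve 3 (λ x y z → con 0 :* x := y :* con 0 :+ z :* con 0) ≈-refl x y z)
    fromℕ*≤sum (suc m) f g {x} {y} {z} bound = begin
      (1# + fromℕ m) * x
        ≈⟨ solve 2 (λ m x → (con 1 :+ m) :* x := x :+ m :* x) ≈-refl (fromℕ m) x ⟩
      x + fromℕ m * x
        ≤⟨ +-mono-≤ (bound zero) (fromℕ*≤sum m (f ∘ suc) (g ∘ suc) (bound ∘ suc)) ⟩
      y * fromℕ (f zero) + z * fromℕ (g zero) + (y * fromℕ (sum (f ∘ suc)) + z * fromℕ (sum (g ∘ suc)))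
        ≈⟨ solve 6 (λ y z a b c d → y :* a :+ z :* b :+ (y :* c :+ z :* d)
                                 := y :* (a :+ c) :+ z :* (b :+ d))
             ≈-refl y z _ _ _ _ ⟩
      y * (fromℕ (f zero) + fromℕ (sum (f ∘ suc))) + z * (fromℕ (g zero) + fromℕ (sum (g ∘ suc)))
        ≈⟨ +-cong (*-congˡ (fromℕ-+ (f zero) _)) (*-congˡ (fromℕ-+ (g zero) _)) ⟨
      y * fromℕ (sum f) + z * fromℕ (sum g) ∎

    -- Every copy is weighted by the number of ordered deletions of d vertices that spare it.
    term : ∀ t d → Coloring (d ℕ.+ t) → Color → Carrier
    term t d χ i = w i * fromℕ (survivors (h i) t d) * fromℕ (copies χ i (G i))

    -- This sums `M≤weight` over all `survivors 0 t d` ordered deletions that leave t vertices. Both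
    -- star sizes are still kept separate, so it serves both lower bounds.
    averaging : ∀ t d (χ : Coloring (d ℕ.+ t)) →
      fromℕ (survivors 0 t d) * M t ≤ term t d χ red + term t d χ blue
    averaging t zero χ = begin
      fromℕ 1 * M t        ≈⟨ ≈-trans (*-congʳ (+-identityʳ 1#)) (*-identityˡ (M t)) ⟩
      M t                  ≤⟨ M≤weight χ ⟩
      weight w G χ         ≈⟨ solve 4 (λ v x w y → v :* x :+ w :* y
                                := v :* (con 1 :+ con 0) :* x :+ w :* (con 1 :+ con 0) :* y)
                                ≈-refl _ _ _ _ ⟩
      term t 0 χ red + term t 0 χ blue ∎
    averaging t (suc d) χ = begin
      fromℕ (suc n ℕ.* D) * M t
        ≈⟨ *-congʳ (fromℕ-* (suc n) D) ⟩
      fromℕ (suc n) * fromℕ D * M t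
        ≈⟨ *-assoc _ _ _ ⟩
      fromℕ (suc n) * (fromℕ D * M t)
        ≤⟨ fromℕ*≤sum (suc n) (λ v → copies (deleteVertex v χ) red (G red))
             (λ v → copies (deleteVertex v χ) blue (G blue))
             (λ v → averaging t d (deleteVertex v χ)) ⟩
      deleted red + deleted blue
        ≤⟨ +-mono-≤ (deleted≤ red) (deleted≤ blue) ⟩
      term t (suc d) χ red + term t (suc d) χ blue ∎
      where
      n = d ℕ.+ t
      D = survivors 0 t d

      deleted : Color → Carrier
      deleted i = w i * fromℕ (survivors (h i) t d) *
                  fromℕ (sum λ v → copies (deleteVertex v χ) i (G i))

      deleted≤ : ∀ i → deleted i ≤ term t (suc d) χ i
      deleted≤ i = begin
        deleted i
          ≤⟨ *-monoˡ-≤ (*-nonNeg (0≤w i) (fromℕ-nonNeg (survivors (h i) t d)))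
               (fromℕ-mono-≤ (sum-copies-deleteVertex χ i (G i))) ⟩
        w i * fromℕ a * fromℕ ((suc n ∸ h i) ℕ.* N)
          ≈⟨ *-congˡ (fromℕ-* (suc n ∸ h i) N) ⟩
        w i * fromℕ a * (fromℕ (suc n ∸ h i) * fromℕ N)
          ≈⟨ solve 4 (λ w a m N → w :* a :* (m :* N) := w :* (m :* a) :* N) ≈-refl _ _ _ _ ⟩
        w i * (fromℕ (suc n ∸ h i) * fromℕ a) * fromℕ N
          ≈⟨ *-congʳ (*-congˡ (fromℕ-* (suc n ∸ h i) a)) ⟨
        term t (suc d) χ i ∎
        where
        a = survivors (h i) t d
        N = copies χ i (G i)

    binom*survivors : ∀ k t d →
      binom (d ℕ.+ t) k * fromℕ (survivors k t d) ≈ fromℕ (survivors 0 t d) * binom t k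
    binom*survivors k t d = begin-equality
      binom (d ℕ.+ t) k * fromℕ (survivors k t d) ≈⟨ fromℕ-* ((d ℕ.+ t) C k) _ ⟨
      fromℕ (((d ℕ.+ t) C k) ℕ.* survivors k t d) ≡⟨ cong fromℕ (C*survivors k t d) ⟩
      fromℕ (survivors 0 t d ℕ.* (t C k))         ≈⟨ fromℕ-* (survivors 0 t d) (t C k) ⟩
      fromℕ (survivors 0 t d) * binom t k         ∎

    M-scaling : ∀ {k t n} → k ℕ.≤ h red → k ℕ.≤ h blue → k ℕ.≤ t → t ℕ.≤ n →
      M t * (binom n k / binom t k) ≤ M n
    M-scaling {k} {t} {n} k≤r k≤b k≤t t≤n =
      subst (λ n → M t * (binom n k / binom t k) ≤ M n) (ℕ.m∸n+n≡m t≤n) (≤M (bound (n ∸ t)))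
      where
      Bₜ = binom t k

      0<Bₜ : 0# < Bₜ
      0<Bₜ = fromℕ-pos (0<nCk k≤t)

      bound : ∀ d (χ : Coloring (d ℕ.+ t)) → M t * (binom (d ℕ.+ t) k / Bₜ) ≤ weight w G χ
      -- The factor `Bₜ * D` clears the division and the number of deletions. Replacing each h i by
      -- k gives both colours the same factor, and the weight splits off.
      bound d χ = *-cancelʳ-≤ (*-pos 0<Bₜ (fromℕ-pos (survivors₀-pos t d))) (begin
        M t * (B / Bₜ) * (Bₜ * D)
          ≈⟨ solve 4 (λ M q b D → M :* q :* (b :* D) := D :* M :* (q :* b)) ≈-refl _ _ _ _ ⟩
        D * M t * (B / Bₜ * Bₜ)
          ≈⟨ *-congˡ (x/y*y≈x B 0<Bₜ) ⟩
        D * M t * B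
          ≤⟨ *-monoʳ-≤ (fromℕ-nonNeg ((d ℕ.+ t) C k))
               (≤-trans (averaging t d χ) (+-mono-≤ (term≤ red k≤r) (term≤ blue k≤b))) ⟩
        (w red * a * N red + w blue * a * N blue) * B
          ≈⟨ solve 6 (λ v w a x y B → (v :* a :* x :+ w :* a :* y) :* B
                                   := (v :* x :+ w :* y) :* (B :* a)) ≈-refl _ _ _ _ _ _ ⟩
        weight w G χ * (B * a)
          ≈⟨ *-congˡ (≈-trans (binom*survivors k t d) (*-comm _ _)) ⟩
        weight w G χ * (Bₜ * D) ∎)
        where
        B = binom (d ℕ.+ t) k
        D = fromℕ (survivors 0 t d)
        a = fromℕ (survivors k t d)

        N : Color → Carrier
        N i = fromℕ (copies χ i (G i))

        term≤ : ∀ i → k ℕ.≤ h i → term t d χ i ≤ w i * a * N i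
        term≤ i k≤h = *-monoʳ-≤ (fromℕ-nonNeg (copies χ i (G i)))
          (*-monoˡ-≤ (0≤w i) (fromℕ-mono-≤ (survivors-antimono t d k≤h)))

    0<2 : 0# < fromℕ 2
    0<2 = fromℕ-pos {2} (s≤s z≤n)

    -- The larger of the two terms in `averaging` is at least half of the left side, whence the 2.
    -- Each colour keeps its own h i, so both binomials for t must be positive.
    largeColor : ∀ {t n} → (∀ i → h i ℕ.≤ t) → t ℕ.≤ n → (χ : Coloring n) → Σ[ i ∈ Color ]
      M t / (fromℕ 2 * w i) * (binom n (h i) / binom t (h i)) ≤ fromℕ (copies χ i (G i))
    largeColor {t} {n} h≤t t≤n =
      subst (λ n → (χ : Coloring n) → Σ[ i ∈ Color ]
        M t / (fromℕ 2 * w i) * (binom n (h i) / binom t (h i)) ≤ fromℕ (copies χ i (G i)))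
        (ℕ.m∸n+n≡m t≤n) (choose (n ∸ t))
      where
      bound : ∀ d (χ : Coloring (d ℕ.+ t)) i →
        fromℕ (survivors 0 t d) * M t ≤ term t d χ i + term t d χ i →
        M t / (fromℕ 2 * w i) * (binom (d ℕ.+ t) (h i) / binom t (h i)) ≤ fromℕ (copies χ i (G i))
      bound d χ i DM≤ = *-cancelʳ-≤ (*-pos 0<2w (*-pos 0<Bₜ (fromℕ-pos (survivors₀-pos t d)))) (begin
        M t / (fromℕ 2 * w i) * (B / Bₜ) * (fromℕ 2 * w i * (Bₜ * D))
          ≈⟨ solve 5 (λ q r x b D → q :* r :* (x :* (b :* D)) := D :* (q :* x) :* (r :* b))
               ≈-refl _ _ _ _ _ ⟩
        D * (M t / (fromℕ 2 * w i) * (fromℕ 2 * w i)) * (B / Bₜ * Bₜ)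
          ≈⟨ *-cong (*-congˡ (x/y*y≈x (M t) 0<2w)) (x/y*y≈x B 0<Bₜ) ⟩
        D * M t * B
          ≤⟨ *-monoʳ-≤ (fromℕ-nonNeg ((d ℕ.+ t) C h i)) DM≤ ⟩
        (w i * a * N + w i * a * N) * B
          ≈⟨ solve 4 (λ w a N B → (w :* a :* N :+ w :* a :* N) :* B
                               := N :* ((con 1 :+ (con 1 :+ con 0)) :* w :* (B :* a)))
               ≈-refl _ _ _ _ ⟩
        N * (fromℕ 2 * w i * (B * a))
          ≈⟨ *-congˡ (*-congˡ (≈-trans (binom*survivors (h i) t d) (*-comm _ _))) ⟩
        N * (fromℕ 2 * w i * (Bₜ * D)) ∎)
        where
        B = binom (d ℕ.+ t) (h i)
        Bₜ = binom t (h i)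
        D = fromℕ (survivors 0 t d)
        a = fromℕ (survivors (h i) t d)
        N = fromℕ (copies χ i (G i))

        0<Bₜ : 0# < Bₜ
        0<Bₜ = fromℕ-pos (0<nCk (h≤t i))

        0<2w : 0# < fromℕ 2 * w i
        0<2w = *-pos 0<2 (0<w i)

      choose : ∀ d (χ : Coloring (d ℕ.+ t)) → Σ[ i ∈ Color ]
        M t / (fromℕ 2 * w i) * (binom (d ℕ.+ t) (h i) / binom t (h i)) ≤ fromℕ (copies χ i (G i))
      choose d χ = [ (λ r≤b → blue , bound d χ blue (≤-trans (averaging t d χ) (+-monoˡ-≤ _ r≤b)))
                   , (λ b≤r → red , bound d χ red (≤-trans (averaging t d χ) (+-monoʳ-≤ _ b≤r)))
                   ]′ (≤-total (term t d χ red) (term t d χ blue))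

  -- The upper bound for stars.

  module Stars
    (r s : Color → ℕ) (2≤r : ∀ i → 2 ℕ.≤ r i) (2≤s : ∀ i → 2 ℕ.≤ s i)
    (w : Color → Carrier) (0<w : ∀ i → 0# < w i) where

    G : Color → OrderedGraph
    G i = 𝒮 (r i) (s i)

    h e : Color → ℕ
    h i = r i ℕ.+ s i ∸ 1
    e i = r i ℕ.+ s i ∸ 2

    open Bounds G w 0<w using (0≤w; M≤weight)

    expected : ℕ → Carrier → Carrier
    expected n p = w red * p ^ e red * binom n (h red)
                 + w blue * (1# - p) ^ e blue * binom n (h blue)

    M≤expected : ∀ n {p} → UnitInterval p → multiplicity w n G ≤ expected n p
    M≤expected n {p} (0≤p , p≤1) = begin
      multiplicity w n G
        -- The multiplicity is below the weight of every colouring, hence below the mean; no good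
        -- colouring has to be extracted.
        ≤⟨ 𝔼-lower (edges n) M≤weight ⟩
      𝔼 (edges n) (weight w G)
        ≈⟨ ≈-trans (𝔼-+ (edges n) _ _) (+-cong (𝔼-* (edges n) (w red) _) (𝔼-* (edges n) (w blue) _)) ⟩
      w red * 𝔼 (edges n) (λ χ → fromℕ (copies χ red (G red))) +
      w blue * 𝔼 (edges n) (λ χ → fromℕ (copies χ blue (G blue)))
        ≤⟨ +-mono-≤ (*-monoˡ-≤ (0≤w red) (𝔼-stars red)) (*-monoˡ-≤ (0≤w blue) (𝔼-stars blue)) ⟩
      w red * (binom n (h red) * p ^ e red) + w blue * (binom n (h blue) * (1# - p) ^ e blue)
        ≈⟨ solve 6 (λ v b x w d y → v :* (b :* x) :+ w :* (d :* y)
                                 := v :* x :* b :+ w :* y :* d) ≈-refl _ _ _ _ _ _ ⟩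
      expected n p ∎
      where
      prob : Color → Carrier
      prob red  = p
      prob blue = 1# - p

      0≤prob : ∀ i → 0# ≤ prob i
      0≤prob red  = 0≤p
      0≤prob blue = 0≤y-x p≤1

      open Expectation n prob 0≤prob (y+[x-y]≈x 1# p)

      𝔼-stars : ∀ i → 𝔼 (edges n) (λ χ → fromℕ (copies χ i (G i))) ≤ binom n (h i) * prob i ^ e i
      𝔼-stars i =
        let L , unique , length≡ = starEdges (r i) (s i) (ℕ.<⇒≤ (2≤r i)) (ℕ.<⇒≤ (2≤s i))
        in subst (λ k → 𝔼 (edges n) (λ χ → fromℕ (copies χ i (G i))) ≤ binom n (h i) * prob i ^ k)
             length≡ (𝔼-copies unique i)

    2≤e : ∀ i → 2 ℕ.≤ e i
    2≤e i = ℕ.∸-monoˡ-≤ 2 (ℕ.+-mono-≤ (2≤r i) (2≤s i))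

    expected-minimum : ∀ n → ∃ (IsMinimum UnitInterval (expected n))
    expected-minimum n = proj₁ scaled , record
      { attained   = let p , p∈I , m≈ = attained in p , p∈I , ≈-trans m≈ (rearrange p)
      ; lowerBound = λ p p∈I → ≤-trans (lowerBound p p∈I) (≤-reflexive (rearrange p))
      }
      where
      scaled : ∃ (IsMinimum UnitInterval λ p →
        w red * binom n (h red) * p ^ e red + w blue * binom n (h blue) * (1# - p) ^ e blue)
      scaled = minimum (*-nonNeg (0≤w red) (fromℕ-nonNeg (n C h red)))
                       (*-nonNeg (0≤w blue) (fromℕ-nonNeg (n C h blue))) (2≤e red) (2≤e blue)

      open IsMinimum (proj₂ scaled)

      rearrange : ∀ p →
        w red * binom n (h red) * p ^ e red + w blue * binom n (h blue) * (1# - p) ^ e blue ≈ expected n p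
      rearrange p = solve 6 (λ v b x w d y → v :* b :* x :+ w :* d :* y
                                          := v :* x :* b :+ w :* y :* d) ≈-refl _ _ _ _ _ _

    minimum-bound : ∀ n →
      Σ[ m ∈ Carrier ] IsMinimum UnitInterval (expected n) m × multiplicity w n G ≤ m
    minimum-bound n =
      let m , isMin = expected-minimum n
          p , p∈I , m≈ = IsMinimum.attained isMin
      in m , isMin , ≤-trans (M≤expected n p∈I) (≤-reflexive (≈-sym m≈))

theorem3p1 :
  ∀ {c ℓ₁ ℓ₂} (ℝ : CompleteOrderedField c ℓ₁ ℓ₂) →
  let open CompleteOrderedField ℝ
      open Multiplicity ℝ
  in
  (r s : Color → ℕ) → (∀ i → 2 ℕ.≤ r i) → (∀ i → 2 ℕ.≤ s i) →
  (w : Color → Carrier) → (∀ i → 0# < w i) →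
  let G : Color → OrderedGraph
      G i = 𝒮 (r i) (s i)
      h : Color → ℕ
      h i = r i ℕ.+ s i ∸ 1
      e : Color → ℕ
      e i = r i ℕ.+ s i ∸ 2
      h⋆ = h red ⊓ h blue
      M : ℕ → Carrier
      M n = multiplicity w n G
  in
  (R : ℕ) → IsOrderedRamseyNumber G R →
  (∀ t n → R ℕ.≤ t → t ℕ.≤ n →
    M t * (binom n h⋆ / binom t h⋆) ≤ M n)
  ×
  (∀ n → Σ[ m ∈ Carrier ]
    IsMinimum UnitInterval
      (λ p → w red  * p ^ e red          * binom n (h red)
           + w blue * (1# - p) ^ e blue  * binom n (h blue)) m
    × M n ≤ m)
  ×
  (∀ t n → R ℕ.≤ t → t ℕ.≤ n → h red ⊔ h blue ℕ.≤ t →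
    (χ : Coloring n) → Σ[ i ∈ Color ]
      M t / (fromℕ 2 * w i) * (binom n (h i) / binom t (h i))
        ≤ fromℕ (copies χ i (G i)))
theorem3p1 ℝ r s 2≤r 2≤s w 0<w R isRamsey =
    (λ t n R≤t t≤n → M-scaling (ℕ.m⊓n≤m (h red) (h blue)) (ℕ.m⊓n≤n (h red) (h blue))
                       (ℕ.≤-trans (arrows⇒⊓size≤ G arrows) R≤t) t≤n)
  , minimum-bound
  , λ t n _ t≤n h⊔≤t → largeColor (λ { red  → ℕ.≤-trans (ℕ.m≤m⊔n (h red) (h blue)) h⊔≤t
                                    ; blue → ℕ.≤-trans (ℕ.m≤n⊔m (h red) (h blue)) h⊔≤t }) t≤n
  where
  open IsOrderedRamseyNumber isRamsey using (arrows)
  open OverReals ℝ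
  open Stars r s 2≤r 2≤s w 0<w using (G; h; minimum-bound)
  open Bounds G w 0<w using (M-scaling; largeColor)
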